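{- Let $n\ge7$ and let $u,v,w\in S_n$ be given in one-line notation by $$u=v=(2,1,3,4,5,\dots,n-2,n,n-1),\qquad w=(4,1,2,3,5,\dots,n-2,n,n-1).$$ Then $c_{N*u,N*v}^{N*w}=1$ for $N=2n-6$, and $c_{N*u,N*v}^{N*w}=0$ for all $N\ge 2n-5$.
   Context: $S_n$ is the symmetric group on $[n]$, embedded in $S_{n+1}$ by fixing $n+1$, and $S_\infty=\bigcup_n S_n$. Schubert polynomials $\mathfrak S_w$ ($w\in S_\infty$) are defined as follows. For $w_0=(n,\dots,1)\in S_n$, put $\mathfrak S_{w_0}=x_1^{n-1}\cdots x_{n-1}$. If $w(i)<w(i+1)$, put $\mathfrak S_w=\partial_i\mathfrak S_{ws_i}$, where $\partial_i f=(f-s_if)/(x_i-x_{i+1})$. They form a $\mathbb Z$-basis of $\mathbb Z[x_1,x_2,\dots]$. Schubert coefficients $c_{u,v}^w$ are defined by $\mathfrak S_u\mathfrak S_v=\sum_w c_{u,v}^w\mathfrak S_w$. The Lehmer code of $w\in S_n$ is $(c_1(w),\dots,c_n(w))$ with $c_i(w)=|\{j>i:w(j)<w(i)\}|$, and it determines $w$. For $N\ge1$, $N*w\in S_{Nn}$ is the permutation with Lehmer code $(Nc_1(w),\dots,Nc_n(w),0,\dots,0)$. -}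

module Defs where

open import Data.Bool using (Bool; true; false; if_then_else_)
open import Data.Nat as ℕ using (ℕ; zero; suc; _∸_; _<ᵇ_; _⊔_)
open import Data.Integer as ℤ using (ℤ; +_)
open import Data.List using (List; []; _∷_; _++_; map; concatMap; upTo; downFrom; length; replicate; filter; foldr)
open import Data.List.Properties using (≡-dec)
open import Data.List.Relation.Unary.All using (All)
open import Data.List.Relation.Binary.Permutation.Propositional using (_↭_)
open import Data.Maybe using (Maybe; just; nothing)
open import Data.Product using (_×_; _,_; proj₁; proj₂)
open import Relation.Nullary using (does)
open import Relation.Binary.PropositionalEquality using (_≡_)

_≟L_ : (a b : List ℕ) → Relation.Nullary.Dec (a ≡ b)
_≟L_ = ≡-dec ℕ._≟_

at : List ℕ → ℕ → ℕ
at []      _       = 0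
at (x ∷ _) zero    = x
at (_ ∷ r) (suc j) = at r j

setAt : List ℕ → ℕ → ℕ → List ℕ
setAt []      zero    v = v ∷ []
setAt []      (suc j) v = 0 ∷ setAt [] j v
setAt (_ ∷ r) zero    v = v ∷ r
setAt (x ∷ r) (suc j) v = x ∷ setAt r j v

-- Polynomials in ℤ[x₁, x₂, …]: a finite formal sum of terms c·x^e,
-- where an exponent vector e = (e₁,e₂,…,eₖ) stands for x₁^e₁ ⋯ xₖ^eₖ
-- (trailing exponents are 0).  Equality is equality of all coefficients.

Monomial : Set
Monomial = List ℕ

Poly : Set
Poly = List (ℤ × Monomial)

padZ : ℕ → List ℕ → List ℕ
padZ m l = l ++ replicate (m ∸ length l) 0

sameMono : Monomial → Monomial → Bool
sameMono a b = does (padZ (length a ⊔ length b) a ≟L padZ (length a ⊔ length b) b)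

sumℤ : List ℤ → ℤ
sumℤ = foldr ℤ._+_ (+ 0)

coeff : Poly → Monomial → ℤ
coeff p e = sumℤ (map proj₁ (filter (λ t → Relation.Nullary.Decidable.Core.T? (sameMono (proj₂ t) e)) p))
  where import Relation.Nullary.Decidable.Core

infix 4 _≈P_
_≈P_ : Poly → Poly → Set
p ≈P q = ∀ e → coeff p e ≡ coeff q e

addExp : Monomial → Monomial → Monomial
addExp []      b       = b
addExp a       []      = a
addExp (x ∷ a) (y ∷ b) = (x ℕ.+ y) ∷ addExp a b

_*P_ : Poly → Poly → Poly
p *P q = concatMap (λ s → map (λ t → (proj₁ s ℤ.* proj₁ t , addExp (proj₂ s) (proj₂ t))) q) p

scaleP : ℤ → Poly → Poly
scaleP c p = map (λ t → (c ℤ.* proj₁ t , proj₂ t)) p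

-- Divided difference ∂_{j+1} (0-based index j, acting on x_{j+1}, x_{j+2}):
-- ∂ f = (f - s f)/(x_{j+1} - x_{j+2}), written out as the exact quotient on
-- each monomial:  with a = exponent of x_{j+1}, b = exponent of x_{j+2},
--   a > b :  x^a y^b ↦   Σ_{k=0}^{a-b-1} x^{a-1-k} y^{b+k}
--   a < b :  x^a y^b ↦ - Σ_{k=0}^{b-a-1} x^{b-1-k} y^{a+k}
--   a = b :  x^a y^b ↦ 0
ddTerm : ℕ → ℤ × Monomial → Poly
ddTerm j (c , m) =
  if b <ᵇ a
  then map (λ k → (c , setAt (setAt m j (a ∸ 1 ∸ k)) (suc j) (b ℕ.+ k))) (upTo (a ∸ b))
  else map (λ k → (ℤ.- c , setAt (setAt m j (b ∸ 1 ∸ k)) (suc j) (a ℕ.+ k))) (upTo (b ∸ a))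
  where
  a = at m j
  b = at m (suc j)

∂ : ℕ → Poly → Poly
∂ j p = concatMap (ddTerm j) p

IsPerm : List ℕ → Set
IsPerm w = w ↭ map suc (upTo (length w))

swapAt : ℕ → List ℕ → List ℕ
swapAt zero    (x ∷ y ∷ r) = y ∷ x ∷ r
swapAt (suc j) (x ∷ r)     = x ∷ swapAt j r
swapAt _       w           = w

firstAscent : List ℕ → Maybe ℕ
firstAscent (x ∷ y ∷ r) = if x <ᵇ y then just 0 else Data.Maybe.map suc (firstAscent (y ∷ r))
  where import Data.Maybe
firstAscent _ = nothing

w₀ : ℕ → List ℕ
w₀ n = map suc (downFrom n)

-- Schubert polynomial recursion with fuel:
--   S_{w₀} = x₁^{n-1} x₂^{n-2} ⋯ x_{n-1},
--   S_w = ∂_i S_{w s_i} for an ascent w(i) < w(i+1).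
-- Each step raises the length by one, so fuel n*n suffices for w ∈ S_n.
schubAux : ℕ → ℕ → List ℕ → Poly
schubAux fuel n w with does (w ≟L w₀ n)
... | true = (+ 1 , downFrom n) ∷ []
... | false with fuel | firstAscent w
...   | zero   | _       = []
...   | suc f  | nothing = []
...   | suc f  | just j  = ∂ j (schubAux f n (swapAt j w))

𝔖 : List ℕ → Poly
𝔖 w = schubAux (length w ℕ.* length w) (length w) w

-- S_∞ : permutations identified up to trailing fixed points.

padPerm : ℕ → List ℕ → List ℕ
padPerm m w = w ++ map (λ k → suc (length w ℕ.+ k)) (upTo (m ∸ length w))

samePerm : List ℕ → List ℕ → Bool
samePerm a b = does (padPerm (length a ⊔ length b) a ≟L padPerm (length a ⊔ length b) b)

lehmer : List ℕ → List ℕ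
lehmer []      = []
lehmer (x ∷ r) = length (filter (λ y → y ℕ.<? x) r) ∷ lehmer r

nth : List ℕ → ℕ → ℕ
nth = at

removeAt : List ℕ → ℕ → List ℕ
removeAt []      _       = []
removeAt (_ ∷ r) zero    = r
removeAt (x ∷ r) (suc j) = x ∷ removeAt r j

decode : List ℕ → List ℕ → List ℕ
decode rem []       = []
decode rem (c ∷ cs) = nth rem c ∷ decode (removeAt rem c) cs

fromLehmer : List ℕ → List ℕ
fromLehmer cs = decode (map suc (upTo (length cs))) cs

_⋆_ : ℕ → List ℕ → List ℕ
N ⋆ w = fromLehmer (map (N ℕ.*_) (lehmer w) ++ replicate (N ℕ.* length w ∸ length w) 0)

-- Schubert coefficients.
-- An expansion is a finite list of pairs (c, w) with w a permutation;
-- it denotes Σ c 𝔖_w.  The coefficient of w in it sums the c's of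
-- entries equal to w in S_∞.

Expansion : Set
Expansion = List (ℤ × List ℕ)

expand : Expansion → Poly
expand E = concatMap (λ t → scaleP (proj₁ t) (𝔖 (proj₂ t))) E

coeffAt : Expansion → List ℕ → ℤ
coeffAt E w = sumℤ (map proj₁ (filter (λ t → Relation.Nullary.Decidable.Core.T? (samePerm (proj₂ t) w)) E))
  where import Relation.Nullary.Decidable.Core

SchubertCoeff≡ : List ℕ → List ℕ → List ℕ → ℤ → Set
SchubertCoeff≡ u v w c =
  (E : Expansion) → All (λ t → IsPerm (proj₂ t)) E →
  (𝔖 u *P 𝔖 v) ≈P expand E → coeffAt E w ≡ c

uPerm : ℕ → List ℕ
uPerm n = 2 ∷ 1 ∷ map (3 ℕ.+_) (upTo (n ∸ 4)) ++ (n ∷ n ∸ 1 ∷ [])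

wPerm : ℕ → List ℕ
wPerm n = 4 ∷ 1 ∷ 2 ∷ 3 ∷ map (5 ℕ.+_) (upTo (n ∸ 6)) ++ (n ∷ n ∸ 1 ∷ [])

{-# OPTIONS --safe #-}

-- Everything is computed by pairing polynomials with linear functionals F on
-- monomials, on which ∂ acts by transposition (DD).  A permutation enters only
-- through its Lehmer code, where exchanging an ascent reads (a, b) ↦ (b + 1, a).
-- By the braid relations the defining recursion may use any ascent, so for a
-- word js leading from the identity to w the functional "constant term of
-- ∂_js" is dual to 𝔖_w: it sends 𝔖_w to 1 and every other 𝔖_v to 0.
--
-- Put d = n − 3.  Raising the code (N, 0^d, N, 0, …) of N*u to the dominant
-- code (N + d + 1, N, 0, …) gives
--   𝔖_{N*u} = Σ_{p+q=d} x₁^{N+p} h_{N−p}(x₂, …, x_{d+2}).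
-- The functional dual to 𝔖_{N*w}, whose code is (3N, 0^d, N, 0, …), kills
-- x₁^k m(x₂, …, x_{d+2}) whenever d + 1 + N ≤ k < 3N, and for k = 3N it is the
-- coefficient of x_{d+2}^N in m.  In 𝔖_{N*u}² the exponents of x₁ are at least
-- 2N and at most 2N + 2d, so nothing survives for N > 2d, and for N = 2d only
-- x₁^{3N} h_d², contributing 1.
module Submission where

open import Defs
open import Data.Nat as ℕ using (ℕ; zero; suc; _≤_; _<_; _≥_; _*_; _∸_; _<ᵇ_; _≤ᵇ_; _⊔_; z≤n; s≤s)
import Data.Nat.Properties as ℕₚ
import Data.Nat.Tactic.RingSolver as ℕSolver
open import Data.Integer using (ℤ; +_; 0ℤ; 1ℤ) renaming (_+_ to _⊕_; _*_ to _⊛_; _-_ to _⊖_; -_ to ⊝_)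
import Data.Integer.Properties as ℤₚ
open import Data.Integer.Tactic.RingSolver using (solve-∀)
open import Data.Bool using (true; false; if_then_else_)
open import Data.Bool.Properties using (T-≡)
open import Data.Empty using (⊥-elim)
open import Data.List using (List; []; _∷_; _++_; map; applyUpTo; upTo; downFrom; length; replicate; foldr; filter)
import Data.List.Properties as Listₚ
open import Data.List.Membership.Propositional using (_∈_)
open import Data.List.Relation.Binary.Permutation.Propositional as Perm using (_↭_; ↭-refl; ↭-sym; ↭-trans; ↭-reflexive; ↭⇒↭ₛ)
open import Data.List.Relation.Binary.Permutation.Propositional.Properties as Permₚ using (All-resp-↭; ∈-resp-↭; ↭-length; drop-∷; ↭-reverse)
import Data.List.Relation.Binary.Permutation.Setoid.Properties as PermSetoidₚ
open import Data.List.Relation.Unary.All as All using (All; []; _∷_)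
import Data.List.Relation.Unary.All.Properties as Allₚ
open import Data.List.Relation.Unary.AllPairs using (AllPairs; []; _∷_)
import Data.List.Relation.Unary.AllPairs.Properties as AllPairsₚ
open import Data.List.Relation.Unary.Any using (here; there)
open import Data.List.Relation.Unary.Linked using (Linked; []; [-]; _∷_)
open import Data.List.Relation.Unary.Unique.Propositional using (Unique)
open import Data.Maybe as Maybe using (Maybe; just; nothing)
open import Data.Product using (_×_; _,_; proj₁; proj₂; ∃-syntax)
open import Data.Sum using (_⊎_; inj₁; inj₂)
open import Data.Unit using (⊤; tt)
open import Function using (_∘_; id; Equivalence)
open import Relation.Binary using (tri<; tri≈; tri>)
open import Relation.Binary.PropositionalEquality
open import Relation.Nullary using (yes; no; ¬_; does)
open import Relation.Nullary.Decidable using (dec-true)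

-- A `Poly` is an unnormalised list of terms, equal to another only coefficient by coefficient, so
-- identities between divided differences would have to be carried through list manipulations.
-- Paired with a functional, a list becomes an integer, and multiplication by x - y becomes the
-- shift that sends f to f (p + 1, q) - f (p, q + 1). This shift is onto (`quot`), so ∂∂ = 0,
-- commutation and the braid relation can all be checked on functionals for which ∂ telescopes.
--
-- The theorem speaks of every expansion E, whose permutations may lie in symmetric groups larger
-- than that of N*w. One functional has to work for all sizes; hence its word must also lead to the
-- code of N*w padded by any number of zeros.
--
-- The bound 3N on the exponent of x₁ arises as follows: along a chain of 3N divided differences an
-- exponent moves one place to the right and loses one at each step, since the constant term
-- tolerates nothing left behind. An exponent below 3N is used up early, and the next divided
-- difference meets a constant.

Functional : Set
Functional = Monomial → ℤ

-- Monomials up to trailing zeros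

infix 4 _≐_
record _≐_ (a b : Monomial) : Set where
  constructor mk≐
  field at-≡ : ∀ i → at a i ≡ at b i
open _≐_ public

-- `setAt` may lengthen a list by zeros, so the identities between divided differences are proved
-- for functionals that cannot see trailing zeros.
record Ext (F : Functional) : Set where
  constructor mkExt
  field ext-≡ : ∀ {a b} → a ≐ b → F a ≡ F b
open Ext public

at-setAt : ∀ l j v → at (setAt l j v) j ≡ v
at-setAt []      zero    v = refl
at-setAt []      (suc j) v = at-setAt [] j v
at-setAt (x ∷ l) zero    v = refl
at-setAt (x ∷ l) (suc j) v = at-setAt l j v

at-setAt-≢ : ∀ l j v i → i ≢ j → at (setAt l j v) i ≡ at l i
at-setAt-≢ []      zero    v zero    i≢j = ⊥-elim (i≢j refl)
at-setAt-≢ []      zero    v (suc i) i≢j = refl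
at-setAt-≢ []      (suc j) v zero    i≢j = refl
at-setAt-≢ []      (suc j) v (suc i) i≢j = at-setAt-≢ [] j v i (i≢j ∘ cong suc)
at-setAt-≢ (x ∷ l) zero    v zero    i≢j = ⊥-elim (i≢j refl)
at-setAt-≢ (x ∷ l) zero    v (suc i) i≢j = refl
at-setAt-≢ (x ∷ l) (suc j) v zero    i≢j = refl
at-setAt-≢ (x ∷ l) (suc j) v (suc i) i≢j = at-setAt-≢ l j v i (i≢j ∘ cong suc)

setAt-cong : ∀ {m m'} → m ≐ m' → ∀ j {v v'} → v ≡ v' → setAt m j v ≐ setAt m' j v'
setAt-cong {m} {m'} m≐m' j {v} refl = mk≐ go
  where
  go : ∀ i → at (setAt m j v) i ≡ at (setAt m' j v) i
  go i with i ℕ.≟ j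
  ... | yes refl = trans (at-setAt m j v) (sym (at-setAt m' j v))
  ... | no  i≢j  = trans (at-setAt-≢ m j v i i≢j) (trans (at-≡ m≐m' i) (sym (at-setAt-≢ m' j v i i≢j)))

set₂ : Monomial → ℕ → ℕ → ℕ → Monomial
set₂ m j p q = setAt (setAt m j p) (suc j) q

set₂-fst : ∀ m j p q → at (set₂ m j p q) j ≡ p
set₂-fst m j p q = trans (at-setAt-≢ (setAt m j p) (suc j) q j (ℕₚ.m≢1+m+n j ∘ λ e → trans e (cong suc (sym (ℕₚ.+-identityʳ j))))) (at-setAt m j p)

set₂-snd : ∀ m j p q → at (set₂ m j p q) (suc j) ≡ q
set₂-snd m j p q = at-setAt (setAt m j p) (suc j) q

set₂-≢ : ∀ m j p q i → i ≢ j → i ≢ suc j → at (set₂ m j p q) i ≡ at m i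
set₂-≢ m j p q i i≢j i≢1+j = trans (at-setAt-≢ (setAt m j p) (suc j) q i i≢1+j) (at-setAt-≢ m j p i i≢j)

set₂-cong : ∀ {m m'} → m ≐ m' → ∀ j p q → set₂ m j p q ≐ set₂ m' j p q
set₂-cong m≐m' j p q = setAt-cong (setAt-cong m≐m' j refl) (suc j) refl

-- Divided differences of two-variable functions

hh : ℕ → (ℕ → ℕ → ℤ) → ℤ
hh zero    f = f 0 0
hh (suc a) f = f (suc a) 0 ⊕ hh a (λ p q → f p (suc q))

-- This is f applied to ∂(x^a y^b): the symmetric factor xy passes through ∂, and what remains is
-- ∂(x^(a+1)) = h_a(x, y) or its negative. Recursion on both exponents avoids the subtractions of
-- `ddTerm`.
dd : (ℕ → ℕ → ℤ) → ℕ → ℕ → ℤ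
dd f zero    zero    = 0ℤ
dd f (suc a) zero    = hh a f
dd f zero    (suc b) = ⊝ hh b f
dd f (suc a) (suc b) = dd (λ p q → f (suc p) (suc q)) a b

hh-cong : ∀ a {f g : ℕ → ℕ → ℤ} → (∀ p q → p ℕ.+ q ≡ a → f p q ≡ g p q) → hh a f ≡ hh a g
hh-cong zero    e = e 0 0 refl
hh-cong (suc a) e = cong₂ _⊕_ (e (suc a) 0 (ℕₚ.+-identityʳ (suc a)))
  (hh-cong a (λ p q s → e p (suc q) (trans (ℕₚ.+-suc p q) (cong suc s))))

dd-cong′ : ∀ {f g : ℕ → ℕ → ℤ} a b → (∀ p q → suc (p ℕ.+ q) ≡ a ℕ.+ b → f p q ≡ g p q) → dd f a b ≡ dd g a b
dd-cong′ zero    zero    e = refl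
dd-cong′ (suc a) zero    e = hh-cong a (λ p q s → e p q (cong suc (trans s (sym (ℕₚ.+-identityʳ a)))))
dd-cong′ zero    (suc b) e = cong ⊝_ (hh-cong b (λ p q s → e p q (cong suc s)))
dd-cong′ (suc a) (suc b) e = dd-cong′ a b (λ p q s → e (suc p) (suc q)
  (cong suc (trans (cong suc (ℕₚ.+-suc p q)) (trans (cong suc s) (sym (ℕₚ.+-suc a b))))))

dd-cong : ∀ {f g : ℕ → ℕ → ℤ} a b → (∀ p q → f p q ≡ g p q) → dd f a b ≡ dd g a b
dd-cong a b e = dd-cong′ a b (λ p q _ → e p q)

hh-0 : ∀ a → hh a (λ _ _ → 0ℤ) ≡ 0ℤ
hh-0 zero    = refl
hh-0 (suc a) = trans (ℤₚ.+-identityˡ _) (hh-0 a)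

dd-0 : ∀ a b → dd (λ _ _ → 0ℤ) a b ≡ 0ℤ
dd-0 zero    zero    = refl
dd-0 (suc a) zero    = hh-0 a
dd-0 zero    (suc b) = cong ⊝_ (hh-0 b)
dd-0 (suc a) (suc b) = dd-0 a b

hh-vanish : ∀ a {f : ℕ → ℕ → ℤ} → (∀ p q → p ℕ.+ q ≡ a → f p q ≡ 0ℤ) → hh a f ≡ 0ℤ
hh-vanish a e = trans (hh-cong a e) (hh-0 a)

dd-vanish : ∀ {f : ℕ → ℕ → ℤ} a b → (∀ p q → suc (p ℕ.+ q) ≡ a ℕ.+ b → f p q ≡ 0ℤ) → dd f a b ≡ 0ℤ
dd-vanish a b e = trans (dd-cong′ a b e) (dd-0 a b)

private
  lin₁ : ∀ x y u v → (x ⊖ y) ⊕ (u ⊖ v) ≡ (x ⊕ u) ⊖ (y ⊕ v)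
  lin₁ = solve-∀
  lin₂ : ∀ x y → ⊝ (x ⊖ y) ≡ ⊝ x ⊖ ⊝ y
  lin₂ = solve-∀
  telescope : ∀ x y z → (x ⊖ y) ⊕ (y ⊖ z) ≡ x ⊖ z
  telescope = solve-∀

hh-sub : ∀ a f g → hh a (λ p q → f p q ⊖ g p q) ≡ hh a f ⊖ hh a g
hh-sub zero    f g = refl
hh-sub (suc a) f g = trans (cong (f (suc a) 0 ⊖ g (suc a) 0 ⊕_) (hh-sub a _ _)) (lin₁ (f (suc a) 0) _ _ _)

dd-sub : ∀ f g a b → dd (λ p q → f p q ⊖ g p q) a b ≡ dd f a b ⊖ dd g a b
dd-sub f g zero    zero    = refl
dd-sub f g (suc a) zero    = hh-sub a f g
dd-sub f g zero    (suc b) = trans (cong ⊝_ (hh-sub b f g)) (lin₂ (hh b f) _)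
dd-sub f g (suc a) (suc b) = dd-sub _ _ a b

hh-telescope : ∀ a (G : ℕ → ℕ → ℤ) → hh a (λ p q → G (suc p) q ⊖ G p (suc q)) ≡ G (suc a) 0 ⊖ G 0 (suc a)
hh-telescope zero    G = refl
hh-telescope (suc a) G = trans (cong (G (suc (suc a)) 0 ⊖ G (suc a) 1 ⊕_) (hh-telescope a (λ p q → G p (suc q))))
  (telescope (G (suc (suc a)) 0) _ _)

-- Multiplying by x - y undoes the division: (x - y) ∂ = 1 - s.
dd-telescope : ∀ (G : ℕ → ℕ → ℤ) a b → dd (λ p q → G (suc p) q ⊖ G p (suc q)) a b ≡ G a b ⊖ G b a
dd-telescope G zero    zero    = sym (ℤₚ.+-inverseʳ (G 0 0))
dd-telescope G (suc a) zero    = hh-telescope a G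
dd-telescope G zero    (suc b) = trans (cong ⊝_ (hh-telescope b G)) (lin₃ (G (suc b) 0) _)
  where
  lin₃ : ∀ x y → ⊝ (x ⊖ y) ≡ y ⊖ x
  lin₃ = solve-∀
dd-telescope G (suc a) (suc b) = dd-telescope (λ p q → G (suc p) (suc q)) a b

hh-sucˡ : ∀ a f → hh (suc a) f ≡ f 0 (suc a) ⊕ hh a (λ p q → f (suc p) q)
hh-sucˡ zero    f = ℤₚ.+-comm (f 1 0) (f 0 1)
hh-sucˡ (suc a) f = trans (cong (f (suc (suc a)) 0 ⊕_) (hh-sucˡ a (λ p q → f p (suc q)))) (shuffle (f (suc (suc a)) 0) (f 0 (suc (suc a))) (hh a (λ p q → f (suc p) (suc q))))
  where
  shuffle : ∀ x y z → x ⊕ (y ⊕ z) ≡ y ⊕ (x ⊕ z)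
  shuffle = solve-∀

hh-flip : ∀ a f → hh a (λ p q → f q p) ≡ hh a f
hh-flip zero    f = refl
hh-flip (suc a) f = trans (cong (f 0 (suc a) ⊕_) (hh-flip a (λ p q → f (suc p) q))) (sym (hh-sucˡ a f))

-- The values of ∂ are symmetric in the two variables.
dd-flip : ∀ f a b → dd (λ p q → f q p) a b ≡ dd f a b
dd-flip f zero    zero    = refl
dd-flip f (suc a) zero    = hh-flip a f
dd-flip f zero    (suc b) = cong ⊝_ (hh-flip b f)
dd-flip f (suc a) (suc b) = dd-flip (λ p q → f (suc p) (suc q)) a b

-- Reading f as a functional on the multiples of x - y, this extends it to all polynomials,
-- normalised to 0 on the powers of y. It puts an arbitrary f into the form required by
-- `dd-telescope`.
quot : (ℕ → ℕ → ℤ) → ℕ → ℕ → ℤ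
quot f zero    q = 0ℤ
quot f (suc p) q = f p q ⊕ quot f p (suc q)

quot-spec : ∀ f p q → f p q ≡ quot f (suc p) q ⊖ quot f p (suc q)
quot-spec f p q = cancel (f p q) _
  where
  cancel : ∀ x y → x ≡ (x ⊕ y) ⊖ y
  cancel = solve-∀

-- With G = `quot f`, the inner ∂ yields G minus its flip, and the outer ∂ does not see the flip.
dd-dd : ∀ f a b → dd (dd f) a b ≡ 0ℤ
dd-dd f a b = begin
  dd (dd f) a b                             ≡⟨ dd-cong a b (λ p q → trans (dd-cong p q (quot-spec f)) (dd-telescope G p q)) ⟩
  dd (λ p q → G p q ⊖ G q p) a b            ≡⟨ dd-sub G _ a b ⟩
  dd G a b ⊖ dd (λ p q → G q p) a b         ≡⟨ cong (dd G a b ⊖_) (dd-flip G a b) ⟩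
  dd G a b ⊖ dd G a b                       ≡⟨ ℤₚ.+-inverseʳ (dd G a b) ⟩
  0ℤ ∎
  where
  open ≡-Reasoning
  G = quot f

dd-comm : ∀ (f : ℕ → ℕ → ℕ → ℕ → ℤ) a b c e →
  dd (λ p q → dd (λ r s → f p q r s) c e) a b ≡ dd (λ r s → dd (λ p q → f p q r s) a b) c e
dd-comm f a b c e = begin
  dd (λ p q → dd (λ r s → f p q r s) c e) a b
    ≡⟨ dd-cong a b (λ p q → trans (dd-cong c e (λ r s → quot-spec (λ p q → f p q r s) p q)) (dd-sub _ _ c e)) ⟩
  dd (λ p q → dd (G (suc p) q) c e ⊖ dd (G p (suc q)) c e) a b
    ≡⟨ dd-telescope (λ p q → dd (G p q) c e) a b ⟩
  dd (G a b) c e ⊖ dd (G b a) c e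
    ≡⟨ dd-sub (G a b) (G b a) c e ⟨
  dd (λ r s → G a b r s ⊖ G b a r s) c e
    ≡⟨ dd-cong c e (λ r s → trans (dd-cong a b (quot-spec (λ p q → f p q r s))) (dd-telescope (λ p q → G p q r s) a b)) ⟨
  dd (λ r s → dd (λ p q → f p q r s) a b) c e ∎
  where
  open ≡-Reasoning
  G : ℕ → ℕ → ℕ → ℕ → ℤ
  G p q r s = quot (λ p q → f p q r s) p q

-- The braid relation in three variables

dd₁₂ dd₂₃ : (ℕ → ℕ → ℕ → ℤ) → ℕ → ℕ → ℕ → ℤ
dd₁₂ f a b c = dd (λ p q → f p q c) a b
dd₂₃ f a b c = dd (λ q r → f a q r) b c

-- (x₁ − x₂)(x₁ − x₃)(x₂ − x₃), acting on functionals.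
vandermonde : (ℕ → ℕ → ℕ → ℤ) → ℕ → ℕ → ℕ → ℤ
vandermonde G a b c = G₂ (suc a) b c ⊖ G₂ a (suc b) c
  where
  G₁ : ℕ → ℕ → ℕ → ℤ
  G₁ a b c = G a (suc b) c ⊖ G a b (suc c)
  G₂ : ℕ → ℕ → ℕ → ℤ
  G₂ a b c = G₁ (suc a) b c ⊖ G₁ a b (suc c)

alternant : (ℕ → ℕ → ℕ → ℤ) → ℕ → ℕ → ℕ → ℤ
alternant G a b c = G a b c ⊖ G b a c ⊖ G a c b ⊕ G c a b ⊕ G b c a ⊖ G c b a

-- The longest divided difference of S₃ is antisymmetrisation divided by the Vandermonde product, so
-- on multiples of that product only the six signed terms remain.
dd₁₂₁-vandermonde : ∀ G a b c → dd₁₂ (dd₂₃ (dd₁₂ (vandermonde G))) a b c ≡ alternant G a b c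
dd₁₂₁-vandermonde G a b c = begin
  dd₁₂ (dd₂₃ (dd₁₂ (vandermonde G))) a b c
    -- The innermost ∂ cancels x₁ - x₂; `e₁` regroups the rest as a difference along x₂ - x₃.
    ≡⟨ dd-cong a b (λ a b → dd-cong b c (λ b c → trans (dd-telescope (λ a b → H a b c) a b)
         (e₁ (G (suc a) (suc b) c) (G (suc a) b (suc c)) (G a (suc b) (suc c)) (G a b (suc (suc c)))
             (G (suc b) (suc a) c) (G (suc b) a (suc c)) (G b (suc a) (suc c)) (G b a (suc (suc c)))))) ⟩
  dd₁₂ (dd₂₃ (λ a b c → K a (suc b) c ⊖ K a b (suc c))) a b c
    -- `e₂` isolates the terms `R b a ⊖ R a b`. They do not telescope, but they are antisymmetric in
    -- a and b, so the last ∂ kills them by `dd-flip`.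
    ≡⟨ dd-cong a b (λ a b → trans (dd-telescope (K a) b c) (e₂ (G (suc a) b c) (G b (suc a) c) (G a b (suc c)) (G b a (suc c)) (G a (suc b) c) (K a c b))) ⟩
  dd (λ a b → ((G (suc a) b c ⊖ G a (suc b) c) ⊖ (R b a ⊖ R a b)) ⊖ (G' (suc a) c b ⊖ G' a c (suc b))) a b
    ≡⟨ trans (dd-sub _ _ a b) (cong₂ _⊖_ (dd-sub _ _ a b) (dd-telescope (λ a b → G' a c b) a b)) ⟩
  (dd (λ a b → G (suc a) b c ⊖ G a (suc b) c) a b ⊖ dd (λ a b → R b a ⊖ R a b) a b) ⊖ (G' a c b ⊖ G' b c a)
    ≡⟨ cong₂ (λ x y → (x ⊖ y) ⊖ (G' a c b ⊖ G' b c a)) (dd-telescope (λ a b → G a b c) a b)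
         (trans (dd-sub _ _ a b) (trans (cong (_⊖ dd R a b) (dd-flip R a b)) (ℤₚ.+-inverseʳ (dd R a b)))) ⟩
  ((G a b c ⊖ G b a c) ⊖ 0ℤ) ⊖ (G' a c b ⊖ G' b c a)
    ≡⟨ e₃ (G a b c) (G b a c) (G a c b) (G c a b) (G b c a) (G c b a) ⟩
  alternant G a b c ∎
  where
  open ≡-Reasoning
  G' H K : ℕ → ℕ → ℕ → ℤ
  H a b c = (G (suc a) (suc b) c ⊖ G (suc a) b (suc c)) ⊖ (G a (suc b) (suc c) ⊖ G a b (suc (suc c)))
  G' a b c = G a b c ⊖ G b a c
  K a b c = G' (suc a) b c ⊖ G' a b (suc c)
  R : ℕ → ℕ → ℤ
  R a b = G a (suc b) c ⊖ G a b (suc c)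
  e₁ : ∀ x₁ x₂ x₃ x₄ y₁ y₂ y₃ y₄ → ((x₁ ⊖ x₂) ⊖ (x₃ ⊖ x₄)) ⊖ ((y₁ ⊖ y₂) ⊖ (y₃ ⊖ y₄))
     ≡ ((x₁ ⊖ y₁) ⊖ (x₃ ⊖ y₂)) ⊖ ((x₂ ⊖ y₃) ⊖ (x₄ ⊖ y₄))
  e₁ = solve-∀
  e₂ : ∀ x y z t u k → ((x ⊖ y) ⊖ (z ⊖ t)) ⊖ k ≡ ((x ⊖ u) ⊖ ((y ⊖ t) ⊖ (u ⊖ z))) ⊖ k
  e₂ = solve-∀
  e₃ : ∀ x y z t u v → ((x ⊖ y) ⊖ 0ℤ) ⊖ ((z ⊖ t) ⊖ (u ⊖ v)) ≡ x ⊖ y ⊖ z ⊕ t ⊕ u ⊖ v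
  e₃ = solve-∀

-- The factors are first reordered: `e₀` brings x₂ - x₃ to the outside, where the innermost ∂ of
-- this word can cancel it.
dd₂₁₂-vandermonde : ∀ G a b c → dd₂₃ (dd₁₂ (dd₂₃ (vandermonde G))) a b c ≡ alternant G a b c
dd₂₁₂-vandermonde G a b c = begin
  dd₂₃ (dd₁₂ (dd₂₃ (vandermonde G))) a b c
    ≡⟨ dd-cong b c (λ b c → dd-cong a b (λ a b → trans (dd-cong b c (e₀ a)) (trans (dd-telescope (M a) b c)
         (e₁ (G (suc (suc a)) b c) (G (suc a) b (suc c)) (G (suc a) (suc b) c) (G a (suc b) (suc c))
             (G (suc (suc a)) c b) (G (suc a) c (suc b)) (G (suc a) (suc c) b) (G a (suc c) (suc b)))))) ⟩
  dd₂₃ (dd₁₂ (λ a b c → K (suc a) b c ⊖ K a (suc b) c)) a b c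
    ≡⟨ dd-cong b c (λ b c → trans (dd-telescope (λ a b → K a b c) a b)
         (e₂ (G (suc a) b c) (G (suc a) c b) (G a b (suc c)) (G a (suc c) b) (G a (suc b) c) (K b a c))) ⟩
  dd (λ b c → ((G a (suc b) c ⊖ G a b (suc c)) ⊖ (R c b ⊖ R b c)) ⊖ (G'' (suc b) a c ⊖ G'' b a (suc c))) b c
    ≡⟨ trans (dd-sub _ _ b c) (cong₂ _⊖_ (dd-sub _ _ b c) (dd-telescope (λ b c → G'' b a c) b c)) ⟩
  (dd (λ b c → G a (suc b) c ⊖ G a b (suc c)) b c ⊖ dd (λ b c → R c b ⊖ R b c) b c) ⊖ (G'' b a c ⊖ G'' c a b)
    ≡⟨ cong₂ (λ x y → (x ⊖ y) ⊖ (G'' b a c ⊖ G'' c a b)) (dd-telescope (G a) b c)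
         (trans (dd-sub _ _ b c) (trans (cong (_⊖ dd R b c) (dd-flip R b c)) (ℤₚ.+-inverseʳ (dd R b c)))) ⟩
  ((G a b c ⊖ G a c b) ⊖ 0ℤ) ⊖ (G'' b a c ⊖ G'' c a b)
    ≡⟨ e₃ (G a b c) (G a c b) (G b a c) (G b c a) (G c a b) (G c b a) ⟩
  alternant G a b c ∎
  where
  open ≡-Reasoning
  G'' K M : ℕ → ℕ → ℕ → ℤ
  G'' a b c = G a b c ⊖ G a c b
  K a b c = G'' (suc a) b c ⊖ G'' a b (suc c)
  M a b c = (G (suc (suc a)) b c ⊖ G (suc a) b (suc c)) ⊖ (G (suc a) (suc b) c ⊖ G a (suc b) (suc c))
  R : ℕ → ℕ → ℤ
  R b c = G (suc a) b c ⊖ G a (suc b) c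
  r₀ : ∀ x₁ x₂ x₃ x₄ x₅ x₆ x₇ → ((x₁ ⊖ x₂) ⊖ (x₃ ⊖ x₄)) ⊖ ((x₅ ⊖ x₃) ⊖ (x₆ ⊖ x₇))
     ≡ ((x₁ ⊖ x₃) ⊖ (x₅ ⊖ x₆)) ⊖ ((x₂ ⊖ x₄) ⊖ (x₃ ⊖ x₇))
  r₀ = solve-∀
  e₀ : ∀ a b c → vandermonde G a b c ≡ M a (suc b) c ⊖ M a b (suc c)
  e₀ a b c = r₀ (G (suc (suc a)) (suc b) c) (G (suc (suc a)) b (suc c)) (G (suc a) (suc b) (suc c)) (G (suc a) b (suc (suc c)))
    (G (suc a) (suc (suc b)) c) (G a (suc (suc b)) (suc c)) (G a (suc b) (suc (suc c)))
  e₁ : ∀ x₁ x₂ x₃ x₄ y₁ y₂ y₃ y₄ → ((x₁ ⊖ x₂) ⊖ (x₃ ⊖ x₄)) ⊖ ((y₁ ⊖ y₂) ⊖ (y₃ ⊖ y₄))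
     ≡ ((x₁ ⊖ y₁) ⊖ (x₂ ⊖ y₃)) ⊖ ((x₃ ⊖ y₂) ⊖ (x₄ ⊖ y₄))
  e₁ = solve-∀
  e₂ : ∀ x y z t u k → ((x ⊖ y) ⊖ (z ⊖ t)) ⊖ k ≡ ((u ⊖ z) ⊖ ((y ⊖ t) ⊖ (x ⊖ u))) ⊖ k
  e₂ = solve-∀
  e₃ : ∀ x y z t u v → ((x ⊖ y) ⊖ 0ℤ) ⊖ ((z ⊖ t) ⊖ (u ⊖ v)) ≡ x ⊖ z ⊖ y ⊕ u ⊕ t ⊖ v
  e₃ = solve-∀

-- Divided differences of functionals in all variables

DD : ℕ → Functional → Functional
DD j F m = dd (λ p q → F (set₂ m j p q)) (at m j) (at m (suc j))

DD-cong : ∀ j {F G : Functional} → (∀ m → F m ≡ G m) → ∀ m → DD j F m ≡ DD j G m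
DD-cong j e m = dd-cong (at m j) (at m (suc j)) (λ p q → e _)

DD-ext : ∀ j {F} → Ext F → Ext (DD j F)
DD-ext j {F} ext = mkExt go
  where
  go : ∀ {a b} → a ≐ b → DD j F a ≡ DD j F b
  go {a} {b} a≐b rewrite at-≡ a≐b j | at-≡ a≐b (suc j) =
    dd-cong (at b j) (at b (suc j)) (λ p q → ext-≡ ext (set₂-cong a≐b j p q))

set₂-≐ : ∀ {m j p q m'} → at m' j ≡ p → at m' (suc j) ≡ q →
  (∀ i → i ≢ j → i ≢ suc j → at m' i ≡ at m i) → set₂ m j p q ≐ m'
set₂-≐ {m} {j} {p} {q} {m'} e₁ e₂ e₃ = mk≐ go
  where
  go : ∀ i → at (set₂ m j p q) i ≡ at m' i
  go i with i ℕ.≟ j | i ℕ.≟ suc j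
  ... | yes refl | _        = trans (set₂-fst m j p q) (sym e₁)
  ... | no _     | yes refl = trans (set₂-snd m j p q) (sym e₂)
  ... | no i≢j   | no i≢1+j = trans (set₂-≢ m j p q i i≢j i≢1+j) (sym (e₃ i i≢j i≢1+j))

DD-set₂ : ∀ j {F} → Ext F → ∀ m p q → DD j F (set₂ m j p q) ≡ dd (λ p q → F (set₂ m j p q)) p q
DD-set₂ j {F} ext m p q rewrite set₂-fst m j p q | set₂-snd m j p q =
  dd-cong p q (λ p' q' → ext-≡ ext (set₂-≐ {set₂ m j p q} (set₂-fst m j p' q') (set₂-snd m j p' q')
    (λ i i≢j i≢1+j → trans (set₂-≢ m j p' q' i i≢j i≢1+j) (sym (set₂-≢ m j p q i i≢j i≢1+j)))))

DD-DD : ∀ j {F} → Ext F → ∀ m → DD j (DD j F) m ≡ 0ℤ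
DD-DD j ext m = trans (dd-cong (at m j) (at m (suc j)) (DD-set₂ j ext m)) (dd-dd _ (at m j) (at m (suc j)))

DD-comm : ∀ i j {F} → Ext F → i ≢ j → i ≢ suc j → j ≢ suc i → ∀ m → DD i (DD j F) m ≡ DD j (DD i F) m
DD-comm i j {F} ext i≢j i≢1+j j≢1+i m = begin
  DD i (DD j F) m
    ≡⟨ dd-cong (at m i) (at m (suc i)) (λ p q → cong₂ (dd (λ r s → F (set₂ (set₂ m i p q) j r s)))
         (set₂-≢ m i p q j (i≢j ∘ sym) j≢1+i) (set₂-≢ m i p q (suc j) (i≢1+j ∘ sym) (i≢j ∘ sym ∘ ℕₚ.suc-injective))) ⟩
  dd (λ p q → dd (λ r s → F (set₂ (set₂ m i p q) j r s)) (at m j) (at m (suc j))) (at m i) (at m (suc i))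
    ≡⟨ dd-comm (λ p q r s → F (set₂ (set₂ m i p q) j r s)) (at m i) (at m (suc i)) (at m j) (at m (suc j)) ⟩
  dd (λ r s → dd (λ p q → F (set₂ (set₂ m i p q) j r s)) (at m i) (at m (suc i))) (at m j) (at m (suc j))
    ≡⟨ dd-cong (at m j) (at m (suc j)) (λ r s → trans
         (dd-cong (at m i) (at m (suc i)) (λ p q → ext-≡ ext (swap p q r s)))
         (cong₂ (dd (λ p q → F (set₂ (set₂ m j r s) i p q)))
           (sym (set₂-≢ m j r s i i≢j i≢1+j)) (sym (set₂-≢ m j r s (suc i) (j≢1+i ∘ sym) (i≢j ∘ ℕₚ.suc-injective))))) ⟩
  DD j (DD i F) m ∎
  where
  open ≡-Reasoning
  swap : ∀ p q r s → set₂ (set₂ m i p q) j r s ≐ set₂ (set₂ m j r s) i p q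
  swap p q r s = set₂-≐ {set₂ m i p q}
    (trans (set₂-≢ (set₂ m j r s) i p q j (i≢j ∘ sym) j≢1+i) (set₂-fst m j r s))
    (trans (set₂-≢ (set₂ m j r s) i p q (suc j) (i≢1+j ∘ sym) (i≢j ∘ sym ∘ ℕₚ.suc-injective)) (set₂-snd m j r s))
    off
    where
    off : ∀ k → k ≢ j → k ≢ suc j → at (set₂ (set₂ m j r s) i p q) k ≡ at (set₂ m i p q) k
    off k k≢j k≢1+j with k ℕ.≟ i | k ℕ.≟ suc i
    ... | yes refl | _        = trans (set₂-fst (set₂ m j r s) i p q) (sym (set₂-fst m i p q))
    ... | no _     | yes refl = trans (set₂-snd (set₂ m j r s) i p q) (sym (set₂-snd m i p q))
    ... | no k≢i   | no k≢1+i = trans (set₂-≢ (set₂ m j r s) i p q k k≢i k≢1+i)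
      (trans (set₂-≢ m j r s k k≢j k≢1+j) (sym (set₂-≢ m i p q k k≢i k≢1+i)))

set₃ : Monomial → ℕ → ℕ → ℕ → ℕ → Monomial
set₃ m j a b c = setAt (set₂ m j a b) (suc (suc j)) c

private
  n≢1+n : ∀ {n} → n ≢ suc n
  n≢1+n {suc n} e = n≢1+n (ℕₚ.suc-injective e)
  n≢2+n : ∀ {n} → n ≢ suc (suc n)
  n≢2+n {suc n} e = n≢2+n (ℕₚ.suc-injective e)

set₃-fst : ∀ m j a b c → at (set₃ m j a b c) j ≡ a
set₃-fst m j a b c = trans (at-setAt-≢ (set₂ m j a b) (suc (suc j)) c j n≢2+n) (set₂-fst m j a b)

set₃-snd : ∀ m j a b c → at (set₃ m j a b c) (suc j) ≡ b
set₃-snd m j a b c = trans (at-setAt-≢ (set₂ m j a b) (suc (suc j)) c (suc j) n≢1+n) (set₂-snd m j a b)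

set₃-thd : ∀ m j a b c → at (set₃ m j a b c) (suc (suc j)) ≡ c
set₃-thd m j a b c = at-setAt (set₂ m j a b) (suc (suc j)) c

set₃-≢ : ∀ m j a b c i → i ≢ j → i ≢ suc j → i ≢ suc (suc j) → at (set₃ m j a b c) i ≡ at m i
set₃-≢ m j a b c i i≢j i≢1+j i≢2+j = trans (at-setAt-≢ (set₂ m j a b) (suc (suc j)) c i i≢2+j) (set₂-≢ m j a b i i≢j i≢1+j)

module _ (j : ℕ) {F : Functional} (ext : Ext F) (m : Monomial) {f : ℕ → ℕ → ℕ → ℤ}
         (F≡f : ∀ a b c → F (set₃ m j a b c) ≡ f a b c) where

  DD-set₃ˡ : ∀ a b c → DD j F (set₃ m j a b c) ≡ dd₁₂ f a b c
  DD-set₃ˡ a b c rewrite set₃-fst m j a b c | set₃-snd m j a b c =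
    dd-cong a b (λ p q → trans (ext-≡ ext (set₂-≐ {set₃ m j a b c} (set₃-fst m j p q c) (set₃-snd m j p q c) (off p q))) (F≡f p q c))
    where
    off : ∀ p q i → i ≢ j → i ≢ suc j → at (set₃ m j p q c) i ≡ at (set₃ m j a b c) i
    off p q i i≢j i≢1+j with i ℕ.≟ suc (suc j)
    ... | yes refl = trans (set₃-thd m j p q c) (sym (set₃-thd m j a b c))
    ... | no i≢2+j = trans (set₃-≢ m j p q c i i≢j i≢1+j i≢2+j) (sym (set₃-≢ m j a b c i i≢j i≢1+j i≢2+j))

  DD-set₃ʳ : ∀ a b c → DD (suc j) F (set₃ m j a b c) ≡ dd₂₃ f a b c
  DD-set₃ʳ a b c rewrite set₃-snd m j a b c | set₃-thd m j a b c =
    dd-cong b c (λ p q → trans (ext-≡ ext (set₂-≐ {set₃ m j a b c} (set₃-snd m j a p q) (set₃-thd m j a p q) (off p q))) (F≡f a p q))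
    where
    off : ∀ p q i → i ≢ suc j → i ≢ suc (suc j) → at (set₃ m j a p q) i ≡ at (set₃ m j a b c) i
    off p q i i≢1+j i≢2+j with i ℕ.≟ j
    ... | yes refl = trans (set₃-fst m j a p q) (sym (set₃-fst m j a b c))
    ... | no i≢j   = trans (set₃-≢ m j a p q i i≢j i≢1+j i≢2+j) (sym (set₃-≢ m j a b c i i≢j i≢1+j i≢2+j))

-- Every function is in the image of the Vandermonde operator, on which both
-- sides of the braid relation are the same alternating sum.
module _ (f : ℕ → ℕ → ℕ → ℤ) where
  private
    q₁₂ q₁₃ q₂₃ : ℕ → ℕ → ℕ → ℤ
    q₁₂ a b c = quot (λ a b → f a b c) a b
    q₁₃ a b c = quot (λ a c → q₁₂ a b c) a c
    q₂₃ a b c = quot (q₁₃ a) b c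

    f≡vandermonde : ∀ a b c → f a b c ≡ vandermonde q₂₃ a b c
    f≡vandermonde a b c = trans (quot-spec (λ a b → f a b c) a b) (cong₂ _⊖_ (step (suc a) b) (step a (suc b)))
      where
      step : ∀ a b → q₁₂ a b c ≡ (q₂₃ (suc a) (suc b) c ⊖ q₂₃ (suc a) b (suc c)) ⊖ (q₂₃ a (suc b) (suc c) ⊖ q₂₃ a b (suc (suc c)))
      step a b = trans (quot-spec (λ a c → q₁₂ a b c) a c) (cong₂ _⊖_ (quot-spec (q₁₃ (suc a)) b c) (quot-spec (q₁₃ a) b (suc c)))

  dd-braid : ∀ a b c → dd₁₂ (dd₂₃ (dd₁₂ f)) a b c ≡ dd₂₃ (dd₁₂ (dd₂₃ f)) a b c
  dd-braid a b c = begin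
    dd₁₂ (dd₂₃ (dd₁₂ f)) a b c
      ≡⟨ dd-cong a b (λ a b → dd-cong b c (λ b c → dd-cong a b (λ a b → f≡vandermonde a b c))) ⟩
    dd₁₂ (dd₂₃ (dd₁₂ (vandermonde q₂₃))) a b c
      ≡⟨ trans (dd₁₂₁-vandermonde q₂₃ a b c) (sym (dd₂₁₂-vandermonde q₂₃ a b c)) ⟩
    dd₂₃ (dd₁₂ (dd₂₃ (vandermonde q₂₃))) a b c
      ≡⟨ dd-cong b c (λ b c → dd-cong a b (λ a b → dd-cong b c (λ b c → f≡vandermonde a b c))) ⟨
    dd₂₃ (dd₁₂ (dd₂₃ f)) a b c ∎
    where open ≡-Reasoning

DD-braid : ∀ j {F} → Ext F → ∀ m → DD j (DD (suc j) (DD j F)) m ≡ DD (suc j) (DD j (DD (suc j) F)) m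
DD-braid j {F} ext m = begin
  DD j (DD (suc j) (DD j F)) m
    ≡⟨ ext-≡ (DD-ext j (DD-ext (suc j) (DD-ext j ext))) m≐ ⟩
  DD j (DD (suc j) (DD j F)) m₀
    ≡⟨ DD-set₃ˡ j (DD-ext (suc j) (DD-ext j ext)) m (DD-set₃ʳ j (DD-ext j ext) m (DD-set₃ˡ j ext m (λ _ _ _ → refl))) _ _ _ ⟩
  dd₁₂ (dd₂₃ (dd₁₂ f)) (at m j) (at m (suc j)) (at m (suc (suc j)))
    ≡⟨ dd-braid f (at m j) (at m (suc j)) (at m (suc (suc j))) ⟩
  dd₂₃ (dd₁₂ (dd₂₃ f)) (at m j) (at m (suc j)) (at m (suc (suc j)))
    ≡⟨ DD-set₃ʳ j (DD-ext j (DD-ext (suc j) ext)) m (DD-set₃ˡ j (DD-ext (suc j) ext) m (DD-set₃ʳ j ext m (λ _ _ _ → refl))) _ _ _ ⟨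
  DD (suc j) (DD j (DD (suc j) F)) m₀
    ≡⟨ ext-≡ (DD-ext (suc j) (DD-ext j (DD-ext (suc j) ext))) m≐ ⟨
  DD (suc j) (DD j (DD (suc j) F)) m ∎
  where
  open ≡-Reasoning
  f : ℕ → ℕ → ℕ → ℤ
  f a b c = F (set₃ m j a b c)
  m₀ = set₃ m j (at m j) (at m (suc j)) (at m (suc (suc j)))
  m≐ : m ≐ m₀
  m≐ = mk≐ go
    where
    go : ∀ i → at m i ≡ at m₀ i
    go i with i ℕ.≟ j | i ℕ.≟ suc j | i ℕ.≟ suc (suc j)
    ... | yes refl | _ | _ = sym (set₃-fst m j _ _ _)
    ... | no _ | yes refl | _ = sym (set₃-snd m j _ _ _)
    ... | no _ | no _ | yes refl = sym (set₃-thd m j _ _ _)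
    ... | no i≢j | no i≢1+j | no i≢2+j = sym (set₃-≢ m j _ _ _ i i≢j i≢1+j i≢2+j)

-- Pairing functionals with polynomials

eval : Functional → Poly → ℤ
eval F []            = 0ℤ
eval F ((c , m) ∷ p) = c ⊛ F m ⊕ eval F p

eval-++ : ∀ F p q → eval F (p ++ q) ≡ eval F p ⊕ eval F q
eval-++ F []            q = sym (ℤₚ.+-identityˡ _)
eval-++ F ((c , m) ∷ p) q = trans (cong (c ⊛ F m ⊕_) (eval-++ F p q)) (sym (ℤₚ.+-assoc (c ⊛ F m) _ _))

eval-cong : ∀ {F G : Functional} → (∀ m → F m ≡ G m) → ∀ p → eval F p ≡ eval G p
eval-cong e []            = refl
eval-cong e ((c , m) ∷ p) = cong₂ (λ x y → c ⊛ x ⊕ y) (e m) (eval-cong e p)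

private
  distr : ∀ c x y → c ⊛ x ⊕ c ⊛ y ≡ c ⊛ (x ⊕ y)
  distr = solve-∀

eval-scale : ∀ F c p → eval F (scaleP c p) ≡ c ⊛ eval F p
eval-scale F c []            = sym (ℤₚ.*-zeroʳ c)
eval-scale F c ((d , m) ∷ p) = trans (cong₂ _⊕_ (ℤₚ.*-assoc c d (F m)) (eval-scale F c p)) (distr c _ _)

eval-* : ∀ F p q → eval F (p *P q) ≡ eval (λ m → eval (λ m' → F (addExp m m')) q) p
eval-* F []            q = refl
eval-* F ((c , m) ∷ p) q = trans (eval-++ F (map (λ t → c ⊛ proj₁ t , addExp m (proj₂ t)) q) (p *P q)) (cong₂ _⊕_ (go q) (eval-* F p q))
  where
  go : ∀ q → eval F (map (λ t → (c ⊛ proj₁ t , addExp m (proj₂ t))) q) ≡ c ⊛ eval (λ m' → F (addExp m m')) q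
  go []            = sym (ℤₚ.*-zeroʳ c)
  go ((d , m') ∷ q) = trans (cong₂ _⊕_ (ℤₚ.*-assoc c d (F (addExp m m'))) (go q)) (distr c _ _)

eval-map-applyUpTo : ∀ F c (g : ℕ → Monomial) (h : ℕ → ℕ) L →
  eval F (map (λ k → (c , g k)) (applyUpTo h L)) ≡ c ⊛ sumℤ (applyUpTo (λ k → F (g (h k))) L)
eval-map-applyUpTo F c g h zero    = sym (ℤₚ.*-zeroʳ c)
eval-map-applyUpTo F c g h (suc L) = trans (cong (c ⊛ F (g (h 0)) ⊕_) (eval-map-applyUpTo F c g (h ∘ suc) L)) (distr c _ _)

sum-applyUpTo-cong : ∀ L {f g : ℕ → ℤ} → (∀ k → k < L → f k ≡ g k) → sumℤ (applyUpTo f L) ≡ sumℤ (applyUpTo g L)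
sum-applyUpTo-cong zero    e = refl
sum-applyUpTo-cong (suc L) e = cong₂ _⊕_ (e 0 (s≤s z≤n)) (sum-applyUpTo-cong L (λ k k<L → e (suc k) (s≤s k<L)))

sum-antidiagonalˡ : ∀ a (f : ℕ → ℕ → ℤ) → sumℤ (applyUpTo (λ k → f (a ∸ k) k) (suc a)) ≡ hh a f
sum-antidiagonalˡ zero    f = ℤₚ.+-identityʳ (f 0 0)
sum-antidiagonalˡ (suc a) f = cong (f (suc a) 0 ⊕_) (sum-antidiagonalˡ a (λ p q → f p (suc q)))

suc-∸-1 : ∀ {a k} → k < a → a ∸ k ≡ suc (a ∸ 1 ∸ k)
suc-∸-1 {suc a} {zero}  _         = refl
suc-∸-1 {suc a} {suc k} (s≤s k<a) = trans (suc-∸-1 k<a) (cong suc (ℕₚ.∸-+-assoc a 1 k))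

-- Connects the explicit sums of `ddTerm` with the recursion `dd`: lowering both exponents by one
-- changes neither the comparison nor the number of summands.
dd-closed : ∀ (f : ℕ → ℕ → ℤ) a b →
  (if b <ᵇ a then sumℤ (applyUpTo (λ k → f (a ∸ 1 ∸ k) (b ℕ.+ k)) (a ∸ b))
             else ⊝ sumℤ (applyUpTo (λ k → f (b ∸ 1 ∸ k) (a ℕ.+ k)) (b ∸ a))) ≡ dd f a b
dd-closed f zero    zero    = refl
dd-closed f (suc a) zero    = sum-antidiagonalˡ a f
dd-closed f zero    (suc b) = cong ⊝_ (sum-antidiagonalˡ b f)
dd-closed f (suc a) (suc b) with b <ᵇ a | dd-closed (λ p q → f (suc p) (suc q)) a b
-- The range k < a ∸ b ensures k < a, so the truncated subtraction is exact.
... | true  | ih = trans (sum-applyUpTo-cong (a ∸ b) (λ k k< → cong (λ x → f x (suc (b ℕ.+ k))) (suc-∸-1 (ℕₚ.<-≤-trans k< (ℕₚ.m∸n≤m a b))))) ih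
... | false | ih = trans (cong ⊝_ (sum-applyUpTo-cong (b ∸ a) (λ k k< → cong (λ x → f x (suc (a ℕ.+ k))) (suc-∸-1 (ℕₚ.<-≤-trans k< (ℕₚ.m∸n≤m b a)))))) ih

eval-ddTerm : ∀ F j c m → eval F (ddTerm j (c , m)) ≡ c ⊛ DD j F m
eval-ddTerm F j c m with at m (suc j) <ᵇ at m j | dd-closed (λ p q → F (set₂ m j p q)) (at m j) (at m (suc j))
... | true  | e = trans (eval-map-applyUpTo F c _ id (at m j ∸ at m (suc j))) (cong (c ⊛_) e)
... | false | e = trans (eval-map-applyUpTo F (⊝ c) _ id (at m (suc j) ∸ at m j)) (trans (neg c _) (cong (c ⊛_) e))
  where
  neg : ∀ x y → ⊝ x ⊛ y ≡ x ⊛ ⊝ y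
  neg = solve-∀

eval-∂ : ∀ F j p → eval F (∂ j p) ≡ eval (DD j F) p
eval-∂ F j []            = refl
eval-∂ F j ((c , m) ∷ p) = trans (eval-++ F (ddTerm j (c , m)) (∂ j p)) (cong₂ _⊕_ (eval-ddTerm F j c m) (eval-∂ F j p))

-- Equality of monomials and of polynomials

≐-refl : ∀ {a} → a ≐ a
≐-refl = mk≐ (λ _ → refl)

≐-sym : ∀ {a b} → a ≐ b → b ≐ a
≐-sym e = mk≐ (λ i → sym (at-≡ e i))

≐-trans : ∀ {a b c} → a ≐ b → b ≐ c → a ≐ c
≐-trans e f = mk≐ (λ i → trans (at-≡ e i) (at-≡ f i))

at-replicate-0 : ∀ n i → at (replicate n 0) i ≡ 0
at-replicate-0 zero    i       = refl
at-replicate-0 (suc n) zero    = refl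
at-replicate-0 (suc n) (suc i) = at-replicate-0 n i

++-replicate-0 : ∀ l n → l ++ replicate n 0 ≐ l
++-replicate-0 l n = mk≐ (go l)
  where
  go : ∀ l i → at (l ++ replicate n 0) i ≡ at l i
  go []      i       = at-replicate-0 n i
  go (x ∷ l) zero    = refl
  go (x ∷ l) (suc i) = go l i

length-padZ : ∀ {m} l → length l ≤ m → length (padZ m l) ≡ m
length-padZ {m} l l≤m = trans (Listₚ.length-++ l) (trans (cong (length l ℕ.+_) (Listₚ.length-replicate (m ∸ length l))) (ℕₚ.m+[n∸m]≡n l≤m))

≐⇒≡ : ∀ {a b} → length a ≡ length b → a ≐ b → a ≡ b
≐⇒≡ {[]}    {[]}    _ _ = refl
≐⇒≡ {x ∷ a} {y ∷ b} l e = cong₂ _∷_ (at-≡ e 0) (≐⇒≡ (ℕₚ.suc-injective l) (mk≐ (λ i → at-≡ e (suc i))))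

sameMono⇒≐ : ∀ a b → sameMono a b ≡ true → a ≐ b
sameMono⇒≐ a b e with padZ (length a ⊔ length b) a ≟L padZ (length a ⊔ length b) b
... | yes p = ≐-trans (≐-sym (++-replicate-0 a _)) (subst (_≐ b) (sym p) (++-replicate-0 b _))

≐⇒sameMono : ∀ {a b} → a ≐ b → sameMono a b ≡ true
≐⇒sameMono {a} {b} e = dec-true (_ ≟L _)
  (≐⇒≡ (trans (length-padZ a (ℕₚ.m≤m⊔n (length a) _)) (sym (length-padZ b (ℕₚ.m≤n⊔m (length a) _))))
       (≐-trans (++-replicate-0 a _) (≐-trans e (≐-sym (++-replicate-0 b _)))))

sameMono-cong : ∀ {a a'} b → a ≐ a' → sameMono a b ≡ sameMono a' b
sameMono-cong {a} {a'} b e with sameMono a b in h | sameMono a' b in h'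
... | true  | true  = refl
... | false | false = refl
... | true  | false with () ← trans (sym h') (≐⇒sameMono (≐-trans (≐-sym e) (sameMono⇒≐ a b h)))
... | false | true  with () ← trans (sym h) (≐⇒sameMono (≐-trans e (sameMono⇒≐ a' b h')))

coeff-∷ : ∀ c m p e → coeff ((c , m) ∷ p) e ≡ (if sameMono m e then c ⊕ coeff p e else coeff p e)
coeff-∷ c m p e with sameMono m e
... | true  = refl
... | false = refl

remove : Monomial → Poly → Poly
remove m []            = []
remove m ((c , k) ∷ p) = if sameMono k m then remove m p else (c , k) ∷ remove m p

length-remove : ∀ m p → length (remove m p) ≤ length p
length-remove m []            = z≤n
length-remove m ((c , k) ∷ p) with sameMono k m
... | true  = ℕₚ.m≤n⇒m≤1+n (length-remove m p)
... | false = s≤s (length-remove m p)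

eval-remove : ∀ {F} → Ext F → ∀ m p → eval F p ≡ coeff p m ⊛ F m ⊕ eval F (remove m p)
eval-remove ext m [] = refl
eval-remove {F} ext m ((c , k) ∷ p) rewrite coeff-∷ c k p m with sameMono k m in h
... | true  = trans (cong₂ (λ x y → c ⊛ x ⊕ y) (ext-≡ ext (sameMono⇒≐ k m h)) (eval-remove ext m p)) (collect c (F m) (coeff p m) _)
  where
  collect : ∀ c x d y → c ⊛ x ⊕ (d ⊛ x ⊕ y) ≡ (c ⊕ d) ⊛ x ⊕ y
  collect = solve-∀
... | false = trans (cong (c ⊛ F k ⊕_) (eval-remove ext m p)) (shuffle (c ⊛ F k) (coeff p m ⊛ F m) _)
  where
  shuffle : ∀ x y z → x ⊕ (y ⊕ z) ≡ y ⊕ (x ⊕ z)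
  shuffle = solve-∀

coeff-remove : ∀ m p e → coeff (remove m p) e ≡ (if sameMono e m then 0ℤ else coeff p e)
coeff-remove m [] e with sameMono e m
... | true  = refl
... | false = refl
coeff-remove m ((c , k) ∷ p) e rewrite coeff-∷ c k p e with sameMono k m in h
... | true  with sameMono k e in h'
...   | true  rewrite trans (coeff-remove m p e) (cong (if_then 0ℤ else coeff p e) (trans (sameMono-cong m (≐-sym (sameMono⇒≐ k e h'))) h))
                    | trans (sameMono-cong m (≐-sym (sameMono⇒≐ k e h'))) h = refl
...   | false = coeff-remove m p e
coeff-remove m ((c , k) ∷ p) e | false rewrite coeff-∷ c k (remove m p) e | coeff-remove m p e with sameMono k e in h'
...   | true  rewrite trans (sameMono-cong m (≐-sym (sameMono⇒≐ k e h'))) h = refl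
...   | false = refl

remove-cong : ∀ m {p q} → p ≈P q → remove m p ≈P remove m q
remove-cong m {p} {q} p≈q e = trans (coeff-remove m p e)
  (trans (cong (if sameMono e m then 0ℤ else_) (p≈q e)) (sym (coeff-remove m q e)))

-- Induction on the number of terms: all terms with the same exponent vector as
-- the first one are split off together.
eval-resp-≈P : ∀ {F} → Ext F → ∀ {p q} → p ≈P q → eval F p ≡ eval F q
eval-resp-≈P {F} ext {p} {q} = go _ p q ℕₚ.≤-refl
  where
  split : ∀ k m p q → (∀ p q → length p ℕ.+ length q ≤ k → p ≈P q → eval F p ≡ eval F q) →
          length (remove m p) ℕ.+ length (remove m q) ≤ k → p ≈P q → eval F p ≡ eval F q
  split k m p q ih l p≈q = trans (eval-remove ext m p) (trans
    (cong₂ (λ c x → c ⊛ F m ⊕ x) (p≈q m) (ih (remove m p) (remove m q) l (remove-cong m {p} {q} p≈q)))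
    (sym (eval-remove ext m q)))

  remove-head : ∀ c m p → length (remove m ((c , m) ∷ p)) ≤ length p
  remove-head c m p rewrite ≐⇒sameMono (≐-refl {m}) = length-remove m p

  go : ∀ k p q → length p ℕ.+ length q ≤ k → p ≈P q → eval F p ≡ eval F q
  go k       []            []            _ _ = refl
  go (suc k) []            ((c , m) ∷ q) (s≤s l) = split k m [] ((c , m) ∷ q) (go k) (ℕₚ.≤-trans (remove-head c m q) l)
  go (suc k) ((c , m) ∷ p) q             (s≤s l) = split k m ((c , m) ∷ p) q (go k)
    (ℕₚ.≤-trans (ℕₚ.+-mono-≤ (remove-head c m p) (length-remove m q)) l)

-- Lehmer codes

-- A strict ascent of w is a weak ascent of its code: if w(i) < w(i+1), every later letter below
-- w(i) is also below w(i+1); if w(i) > w(i+1), then w(i) counts all that w(i+1) counts and w(i+1)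
-- itself.
data Asc : ℕ → List ℕ → Set where
  here  : ∀ {a b r} → a ≤ b → Asc 0 (a ∷ b ∷ r)
  there : ∀ {j x r} → Asc j r → Asc (suc j) (x ∷ r)

-- The effect on the Lehmer code of exchanging w(j+1) < w(j+2).
op : ℕ → List ℕ → List ℕ
op zero    (a ∷ b ∷ r) = suc b ∷ a ∷ r
op (suc j) (x ∷ r)     = x ∷ op j r
op _       c           = c

firstAsc : List ℕ → Maybe ℕ
firstAsc (x ∷ y ∷ r) = if x ≤ᵇ y then just 0 else Maybe.map suc (firstAsc (y ∷ r))
firstAsc _           = nothing

≤ᵇ-false : ∀ {a b} → (a ≤ᵇ b) ≡ false → b < a
≤ᵇ-false {a} {b} e with a ℕ.≤? b
... | yes p with () ← trans (sym e) (Equivalence.to T-≡ (ℕₚ.≤⇒≤ᵇ p))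
... | no ¬p = ℕₚ.≰⇒> ¬p

≤ᵇ-true : ∀ {a b} → (a ≤ᵇ b) ≡ true → a ≤ b
≤ᵇ-true {a} {b} e = ℕₚ.≤ᵇ⇒≤ a b (Equivalence.from T-≡ e)

firstAsc-Asc : ∀ c {i} → firstAsc c ≡ just i → Asc i c
firstAsc-Asc (x ∷ y ∷ r) e with x ≤ᵇ y in h
firstAsc-Asc (x ∷ y ∷ r) refl | true = here (≤ᵇ-true h)
firstAsc-Asc (x ∷ y ∷ r) e    | false with firstAsc (y ∷ r) in h'
firstAsc-Asc (x ∷ y ∷ r) refl | false | just i = there (firstAsc-Asc (y ∷ r) h')

firstAsc-nothing : ∀ c → firstAsc c ≡ nothing → ∀ {j} → ¬ Asc j c
firstAsc-nothing (x ∷ y ∷ r) e a with x ≤ᵇ y in h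
firstAsc-nothing (x ∷ y ∷ r) e (here x≤y) | false = ℕₚ.<⇒≱ (≤ᵇ-false h) x≤y
firstAsc-nothing (x ∷ y ∷ r) e (there a)  | false with firstAsc (y ∷ r) in h'
... | nothing = firstAsc-nothing (y ∷ r) h' a
firstAsc-nothing (x ∷ [])    e (there ())

op-far : ∀ {i j c} → i ≢ j → i ≢ suc j → j ≢ suc i → Asc i c → Asc j c → Asc j (op i c) × op j (op i c) ≡ op i (op j c)
op-far i≢j i≢1+j j≢1+i (here _)  (here _)          = ⊥-elim (i≢j refl)
op-far i≢j i≢1+j j≢1+i (here _)  (there (here _))  = ⊥-elim (j≢1+i refl)
op-far i≢j i≢1+j j≢1+i (here _)  (there (there b)) = there (there b) , refl
op-far i≢j i≢1+j j≢1+i (there (here _)) (here _)   = ⊥-elim (i≢1+j refl)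
op-far i≢j i≢1+j j≢1+i (there (there a)) (here p)  = here p , refl
op-far i≢j i≢1+j j≢1+i (there a) (there b) with op-far (i≢j ∘ cong suc) (i≢1+j ∘ cong suc) (j≢1+i ∘ cong suc) a b
... | a' , e = there a' , cong (_ ∷_) e

record Braid (i : ℕ) (c : List ℕ) : Set where
  field
    asc₁₂  : Asc (suc i) (op i c)
    asc₁₂₁ : Asc i (op (suc i) (op i c))
    asc₂₁  : Asc i (op (suc i) c)
    asc₂₁₂ : Asc (suc i) (op i (op (suc i) c))
    op-121 : op i (op (suc i) (op i c)) ≡ op (suc i) (op i (op (suc i) c))

-- Both routes raise (a, b, c) with a ≤ b ≤ c to (c + 2, b + 1, a).
op-braid : ∀ {i c} → Asc i c → Asc (suc i) c → Braid i c
op-braid (here a≤b) (there (here b≤c)) = record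
  { asc₁₂ = there (here (ℕₚ.≤-trans a≤b b≤c)) ; asc₁₂₁ = here (s≤s b≤c)
  ; asc₂₁ = here (ℕₚ.m≤n⇒m≤1+n (ℕₚ.≤-trans a≤b b≤c)) ; asc₂₁₂ = there (here a≤b) ; op-121 = refl }
op-braid (there a) (there b) = record
  { asc₁₂ = there (Braid.asc₁₂ r) ; asc₁₂₁ = there (Braid.asc₁₂₁ r) ; asc₂₁ = there (Braid.asc₂₁ r)
  ; asc₂₁₂ = there (Braid.asc₂₁₂ r) ; op-121 = cong (_ ∷_) (Braid.op-121 r) }
  where r = op-braid a b

-- The value of F on the Schubert polynomial with code c, computed with k steps
-- of fuel; 0 if the fuel runs out.
Sc : ℕ → List ℕ → Functional → ℤ
Sc zero    c F = 0ℤ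
Sc (suc k) c F with firstAsc c
... | nothing = F c
... | just i  = Sc k (op i c) (DD i F)

Sc-cong : ∀ k c {F G} → (∀ m → F m ≡ G m) → Sc k c F ≡ Sc k c G
Sc-cong zero    c e = refl
Sc-cong (suc k) c e with firstAsc c
... | nothing = e c
... | just i  = Sc-cong k (op i c) (DD-cong i e)

degree : List ℕ → ℕ
degree []      = 0
degree (x ∷ c) = x ℕ.+ degree c

degree-setAt : ∀ m j v → degree (setAt m j v) ℕ.+ at m j ≡ degree m ℕ.+ v
degree-setAt []      zero    v = trans (ℕₚ.+-identityʳ (v ℕ.+ 0)) (ℕₚ.+-identityʳ v)
degree-setAt []      (suc j) v = degree-setAt [] j v
degree-setAt (x ∷ m) zero    v = trans (ℕₚ.+-comm (v ℕ.+ degree m) x) (trans (cong (x ℕ.+_) (ℕₚ.+-comm v _)) (sym (ℕₚ.+-assoc x _ v)))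
degree-setAt (x ∷ m) (suc j) v = trans (ℕₚ.+-assoc x _ _) (trans (cong (x ℕ.+_) (degree-setAt m j v)) (sym (ℕₚ.+-assoc x _ v)))

degree-set₂ : ∀ m j p q → degree (set₂ m j p q) ℕ.+ (at m j ℕ.+ at m (suc j)) ≡ degree m ℕ.+ (p ℕ.+ q)
degree-set₂ m j p q = begin
  D ℕ.+ (at m j ℕ.+ at m (suc j))              ≡⟨ cong (D ℕ.+_) (ℕₚ.+-comm (at m j) _) ⟩
  D ℕ.+ (at m (suc j) ℕ.+ at m j)              ≡⟨ ℕₚ.+-assoc D _ _ ⟨
  D ℕ.+ at m (suc j) ℕ.+ at m j                ≡⟨ cong (λ x → D ℕ.+ x ℕ.+ at m j) (at-setAt-≢ m j p (suc j) (ℕₚ.1+n≢n)) ⟨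
  D ℕ.+ at (setAt m j p) (suc j) ℕ.+ at m j    ≡⟨ cong (ℕ._+ at m j) (degree-setAt (setAt m j p) (suc j) q) ⟩
  degree (setAt m j p) ℕ.+ q ℕ.+ at m j        ≡⟨ swap (degree (setAt m j p)) q (at m j) ⟩
  degree (setAt m j p) ℕ.+ at m j ℕ.+ q        ≡⟨ cong (ℕ._+ q) (degree-setAt m j p) ⟩
  degree m ℕ.+ p ℕ.+ q                         ≡⟨ ℕₚ.+-assoc (degree m) p q ⟩
  degree m ℕ.+ (p ℕ.+ q) ∎
  where
  open ≡-Reasoning
  D = degree (set₂ m j p q)
  swap : ∀ x y z → x ℕ.+ y ℕ.+ z ≡ x ℕ.+ z ℕ.+ y
  swap x y z = trans (ℕₚ.+-assoc x y z) (trans (cong (x ℕ.+_) (ℕₚ.+-comm y z)) (sym (ℕₚ.+-assoc x z y)))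

degree-op : ∀ {j c} → Asc j c → degree (op j c) ≡ suc (degree c)
degree-op {c = a ∷ b ∷ r} (here _) = cong suc (trans (sym (ℕₚ.+-assoc b a _)) (trans (cong (ℕ._+ degree r) (ℕₚ.+-comm b a)) (ℕₚ.+-assoc a b _)))
degree-op {c = x ∷ r} (there a) = trans (cong (x ℕ.+_) (degree-op a)) (ℕₚ.+-suc x _)

-- Schubert polynomials are homogeneous of degree the sum of the code: raising adds one to that sum,
-- and ∂ takes one off the degree.
Sc-degree : ∀ k c {F} → (∀ m → degree m ≡ degree c → F m ≡ 0ℤ) → Sc k c F ≡ 0ℤ
Sc-degree zero    c v = refl
Sc-degree (suc k) c {F} v with firstAsc c in h
... | nothing = v c refl
... | just i  = Sc-degree k (op i c) λ m d → dd-vanish (at m i) (at m (suc i)) λ p q s → v _ (ℕₚ.suc-injective (ℕₚ.+-cancelʳ-≡ (p ℕ.+ q) _ _ (begin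
  suc (degree (set₂ m i p q)) ℕ.+ (p ℕ.+ q)                 ≡⟨ ℕₚ.+-suc (degree (set₂ m i p q)) (p ℕ.+ q) ⟨
  degree (set₂ m i p q) ℕ.+ suc (p ℕ.+ q)                   ≡⟨ cong (degree (set₂ m i p q) ℕ.+_) s ⟩
  degree (set₂ m i p q) ℕ.+ (at m i ℕ.+ at m (suc i))       ≡⟨ degree-set₂ m i p q ⟩
  degree m ℕ.+ (p ℕ.+ q)                                    ≡⟨ cong (ℕ._+ (p ℕ.+ q)) (trans d (degree-op (firstAsc-Asc c h))) ⟩
  suc (degree c) ℕ.+ (p ℕ.+ q) ∎)))
  where open ≡-Reasoning

Sc-vanish : ∀ k c {F} → (∀ m → F m ≡ 0ℤ) → Sc k c F ≡ 0ℤ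
Sc-vanish k c v = Sc-degree k c (λ m _ → v m)

-- Independence of the chosen ascent

private
  -- The recursion may start at any ascent j instead of the first. The proof is a confluence
  -- argument by induction on the fuel: two ascents are joined by commutation when far apart and by
  -- the braid relation when adjacent. Both sides always use the same number of steps, so where the
  -- fuel runs out both are 0.
  Q : ℕ → Set
  Q k = ∀ c j {F} → Ext F → Asc j c → Sc (suc k) c F ≡ Sc k (op j c) (DD j F)

  Q-far : ∀ k → (∀ {l} → l < k → Q l) → ∀ c i j {F} → Ext F → i ≢ j → i ≢ suc j → j ≢ suc i → Asc i c → Asc j c →
          Sc k (op i c) (DD i F) ≡ Sc k (op j c) (DD j F)
  Q-far zero    ih c i j ext i≢j i≢1+j j≢1+i a b = refl
  Q-far (suc k) ih c i j {F} ext i≢j i≢1+j j≢1+i a b = begin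
    Sc (suc k) (op i c) (DD i F)              ≡⟨ ih ℕₚ.≤-refl (op i c) j (DD-ext i ext) (proj₁ (op-far i≢j i≢1+j j≢1+i a b)) ⟩
    Sc k (op j (op i c)) (DD j (DD i F))      ≡⟨ cong (λ c → Sc k c (DD j (DD i F))) (proj₂ (op-far i≢j i≢1+j j≢1+i a b)) ⟩
    Sc k (op i (op j c)) (DD j (DD i F))      ≡⟨ Sc-cong k _ (DD-comm i j ext i≢j i≢1+j j≢1+i) ⟨
    Sc k (op i (op j c)) (DD i (DD j F))      ≡⟨ ih ℕₚ.≤-refl (op j c) i (DD-ext j ext) (proj₁ (op-far (i≢j ∘ sym) j≢1+i i≢1+j b a)) ⟨
    Sc (suc k) (op j c) (DD j F) ∎
    where open ≡-Reasoning

  Q-adj : ∀ k → (∀ {l} → l < k → Q l) → ∀ c i {F} → Ext F → Asc i c → Asc (suc i) c →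
          Sc k (op i c) (DD i F) ≡ Sc k (op (suc i) c) (DD (suc i) F)
  Q-adj zero          ih c i ext a b = refl
  -- One further raise exhausts the fuel, so both sides are 0.
  Q-adj (suc zero)    ih c i ext a b = trans (ih (s≤s z≤n) _ (suc i) (DD-ext i ext) (Braid.asc₁₂ (op-braid a b)))
    (sym (ih (s≤s z≤n) _ i (DD-ext (suc i) ext) (Braid.asc₂₁ (op-braid a b))))
  Q-adj (suc (suc k)) ih c i {F} ext a b = begin
    Sc (suc (suc k)) (op i c) (DD i F)
      ≡⟨ ih ℕₚ.≤-refl _ (suc i) (DD-ext i ext) asc₁₂ ⟩
    Sc (suc k) (op (suc i) (op i c)) (DD (suc i) (DD i F))
      ≡⟨ ih (s≤s (ℕₚ.n≤1+n k)) _ i (DD-ext (suc i) (DD-ext i ext)) asc₁₂₁ ⟩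
    Sc k (op i (op (suc i) (op i c))) (DD i (DD (suc i) (DD i F)))
      ≡⟨ trans (Sc-cong k _ (DD-braid i ext)) (cong (λ c → Sc k c (DD (suc i) (DD i (DD (suc i) F)))) op-121) ⟩
    Sc k (op (suc i) (op i (op (suc i) c))) (DD (suc i) (DD i (DD (suc i) F)))
      ≡⟨ ih (s≤s (ℕₚ.n≤1+n k)) _ (suc i) (DD-ext i (DD-ext (suc i) ext)) asc₂₁₂ ⟨
    Sc (suc k) (op i (op (suc i) c)) (DD i (DD (suc i) F))
      ≡⟨ ih ℕₚ.≤-refl _ i (DD-ext (suc i) ext) asc₂₁ ⟨
    Sc (suc (suc k)) (op (suc i) c) (DD (suc i) F) ∎
    where
    open ≡-Reasoning
    open Braid (op-braid a b)

  Q-step : ∀ k → (∀ {l} → l < k → Q l) → Q k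
  Q-step k ih c j ext b with firstAsc c in h
  ... | nothing = ⊥-elim (firstAsc-nothing c h b)
  ... | just i with i ℕ.≟ j | i ℕ.≟ suc j | j ℕ.≟ suc i
  ...   | yes refl | _ | _ = refl
  ...   | no _ | yes refl | _ = sym (Q-adj k ih c j ext b (firstAsc-Asc c h))
  ...   | no _ | no _ | yes refl = Q-adj k ih c i ext (firstAsc-Asc c h) b
  ...   | no i≢j | no i≢1+j | no j≢1+i = Q-far k ih c i j ext i≢j i≢1+j j≢1+i (firstAsc-Asc c h) b

  Q-below : ∀ k {l} → l < k → Q l
  Q-below (suc k) (s≤s l≤k) = Q-step _ (λ l'<l → Q-below k (ℕₚ.<-≤-trans l'<l l≤k))

Sc-step : ∀ k c j {F} → Ext F → Asc j c → Sc (suc k) c F ≡ Sc k (op j c) (DD j F)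
Sc-step k = Q-step k (Q-below k)

-- Valid codes and sufficient fuel

Valid : List ℕ → Set
Valid []      = ⊤
Valid (x ∷ c) = x ≤ length c × Valid c

tri : ℕ → ℕ
tri zero    = 0
tri (suc n) = n ℕ.+ tri n

length-op : ∀ {j c} → Asc j c → length (op j c) ≡ length c
length-op (here _)  = refl
length-op (there a) = cong suc (length-op a)

op-valid : ∀ {j c} → Asc j c → Valid c → Valid (op j c)
op-valid (here a≤b) (_ , b≤ , v) = s≤s b≤ , ℕₚ.≤-trans a≤b b≤ , v
op-valid (there a) (x≤ , v) = subst (_ ≤_) (sym (length-op a)) x≤ , op-valid a v

degree≤tri : ∀ c → Valid c → degree c ≤ tri (length c)
degree≤tri []      _        = z≤n
degree≤tri (x ∷ c) (x≤ , v) = ℕₚ.+-mono-≤ x≤ (degree≤tri c v)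

-- Each raise adds one to the degree, which is at most `tri (length c)` for valid codes. The
-- inequality is strict because `Sc` needs one more unit to evaluate F at the end.
Enough : ℕ → List ℕ → Set
Enough k c = tri (length c) < degree c ℕ.+ k

enough-op : ∀ {k j c} → Asc j c → Enough (suc k) c → Enough k (op j c)
enough-op {k} {j} {c} a e rewrite length-op a | degree-op a | ℕₚ.+-suc (degree c) k = e

¬enough-zero : ∀ c → Valid c → ¬ Enough 0 c
¬enough-zero c v e = ℕₚ.<⇒≱ e (subst (_≤ tri (length c)) (sym (ℕₚ.+-identityʳ (degree c))) (degree≤tri c v))

Sc-suc : ∀ k c {F} → Valid c → Enough k c → Sc (suc k) c F ≡ Sc k c F
Sc-suc zero    c v e = ⊥-elim (¬enough-zero c v e)
Sc-suc (suc k) c v e with firstAsc c in h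
... | nothing = refl
... | just i  = Sc-suc k (op i c) (op-valid (firstAsc-Asc c h) v) (enough-op (firstAsc-Asc c h) e)

Sc-+ : ∀ k l c {F} → Valid c → Enough k c → Sc (l ℕ.+ k) c F ≡ Sc k c F
Sc-+ k zero    c v e = refl
Sc-+ k (suc l) c v e = trans (Sc-suc (l ℕ.+ k) c v (ℕₚ.≤-trans e (ℕₚ.+-monoʳ-≤ (degree c) (ℕₚ.m≤n+m k l)))) (Sc-+ k l c v e)

⟦_⟧ : List ℕ → Functional → ℤ
⟦ c ⟧ = Sc (suc (tri (length c))) c

enough-tri : ∀ c → Enough (suc (tri (length c))) c
enough-tri c = ℕₚ.m≤n+m _ (degree c)

⟦⟧-step : ∀ {j c F} → Valid c → Ext F → Asc j c → ⟦ c ⟧ F ≡ ⟦ op j c ⟧ (DD j F)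
⟦⟧-step {j} {c} {F} v ext a rewrite length-op a = trans (Sc-step _ c j ext a)
  (sym (Sc-suc (tri (length c)) (op j c) (op-valid a v)
    (subst₂ (λ x y → tri x < y ℕ.+ tri (length c)) (sym (length-op a)) (sym (degree-op a)) (s≤s (ℕₚ.m≤n+m _ (degree c))))))

-- At an ascent j, 𝔖_c is itself a value of ∂_j, and ∂_j ∂_j = 0.
⟦⟧-asc : ∀ {j c F} → Valid c → Ext F → Asc j c → ⟦ c ⟧ (DD j F) ≡ 0ℤ
⟦⟧-asc {j} {c} v ext a = trans (⟦⟧-step v (DD-ext j ext) a) (Sc-vanish _ (op j c) (DD-DD j ext))

-- Dominant codes

at-op-fst : ∀ {j c} → Asc j c → at (op j c) j ≡ suc (at c (suc j))
at-op-fst (here _)  = refl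
at-op-fst (there a) = at-op-fst a

at-op-snd : ∀ {j c} → Asc j c → at (op j c) (suc j) ≡ at c j
at-op-snd (here _)  = refl
at-op-snd (there a) = at-op-snd a

at-op-≢ : ∀ {j c} → Asc j c → ∀ i → i ≢ j → i ≢ suc j → at (op j c) i ≡ at c i
at-op-≢ (here _)  zero          i≢j i≢1+j = ⊥-elim (i≢j refl)
at-op-≢ (here _)  (suc zero)    i≢j i≢1+j = ⊥-elim (i≢1+j refl)
at-op-≢ (here _)  (suc (suc i)) i≢j i≢1+j = refl
at-op-≢ (there a) zero          i≢j i≢1+j = refl
at-op-≢ (there a) (suc i)       i≢j i≢1+j = at-op-≢ a i (i≢j ∘ cong suc) (i≢1+j ∘ cong suc)

asc-flat : ∀ {j c} → Asc j c → Linked _≥_ c → at c j ≡ at c (suc j)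
asc-flat (here a≤b) (b≤a ∷ _) = ℕₚ.≤-antisym a≤b b≤a
asc-flat (there a)  (_ ∷ l)   = asc-flat a l
asc-flat (there ()) [-]

-- In a weakly decreasing code an ascent is a tie. The entry before the first tie is strictly
-- larger, so (y, y) can become (y + 1, y); the extra head x carries this strict inequality through
-- the recursion.
op-dominant : ∀ {x} c {i} → firstAsc c ≡ just i → at c 0 < x → Linked _≥_ c → Linked _≥_ (x ∷ op i c)
op-dominant (y ∷ z ∷ r) e y<x (z≤y ∷ l) with y ≤ᵇ z in h
op-dominant (y ∷ z ∷ r) refl y<x (z≤y ∷ l) | true with refl ← ℕₚ.≤-antisym (≤ᵇ-true h) z≤y = y<x ∷ ℕₚ.n≤1+n y ∷ l
op-dominant (y ∷ z ∷ r) e y<x (z≤y ∷ l) | false with firstAsc (z ∷ r) in h'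
op-dominant (y ∷ z ∷ r) refl y<x (z≤y ∷ l) | false | just i = ℕₚ.<⇒≤ y<x ∷ op-dominant (z ∷ r) h' (≤ᵇ-false h) l

dd-diag : ∀ f a → dd f (suc a) a ≡ f a a
dd-diag f zero    = refl
dd-diag f (suc a) = dd-diag (λ p q → f (suc p) (suc q)) a

linked-tail : ∀ {x} {c : List ℕ} → Linked _≥_ (x ∷ c) → Linked _≥_ c
linked-tail [-]     = []
linked-tail (_ ∷ l) = l

-- Dominant permutations have 𝔖_c = x^c: breaking the first tie leaves the code dominant, and ∂
-- sends x^(a+1) y^a back to x^a y^a.
Sc-dominant : ∀ k c {F} → Valid c → Enough k c → Linked _≥_ c → Ext F → Sc k c F ≡ F c
Sc-dominant zero    c v e l ext = ⊥-elim (¬enough-zero c v e)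
Sc-dominant (suc k) c {F} v e l ext with firstAsc c in h
... | nothing = refl
... | just i  = begin
  Sc k (op i c) (DD i F)
    -- For `op-dominant` an auxiliary entry, one more than the first of `c`, is put in front and
    -- dropped again.
    ≡⟨ Sc-dominant k (op i c) (op-valid a v) (enough-op a e) (linked-tail (op-dominant c h ℕₚ.≤-refl l)) (DD-ext i ext) ⟩
  dd (λ p q → F (set₂ (op i c) i p q)) (at (op i c) i) (at (op i c) (suc i))
    ≡⟨ cong₂ (dd _) (at-op-fst a) (trans (at-op-snd a) (asc-flat a l)) ⟩
  dd (λ p q → F (set₂ (op i c) i p q)) (suc (at c (suc i))) (at c (suc i))
    ≡⟨ dd-diag _ (at c (suc i)) ⟩
  F (set₂ (op i c) i (at c (suc i)) (at c (suc i)))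
    ≡⟨ ext-≡ ext (set₂-≐ (asc-flat a l) refl (λ k k≢i k≢1+i → sym (at-op-≢ a k k≢i k≢1+i))) ⟩
  F c ∎
  where
  open ≡-Reasoning
  a = firstAsc-Asc c h

⟦⟧-dominant : ∀ {c F} → Valid c → Linked _≥_ c → Ext F → ⟦ c ⟧ F ≡ F c
⟦⟧-dominant {c} v l ext = Sc-dominant (suc (tri (length c))) c v (enough-tri c) l ext

-- Stability under S_n ⊂ S_{n+r}

zeros : ℕ → List ℕ
zeros n = replicate n 0

zeros-valid : ∀ n → Valid (zeros n)
zeros-valid zero    = tt
zeros-valid (suc n) = z≤n , zeros-valid n

zeros-linked : ∀ n → Linked _≥_ (zeros n)
zeros-linked zero          = []
zeros-linked (suc zero)    = [-]
zeros-linked (suc (suc n)) = z≤n ∷ zeros-linked (suc n)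

++-zeros-valid : ∀ c r → Valid c → Valid (c ++ zeros r)
++-zeros-valid []      r v        = zeros-valid r
++-zeros-valid (x ∷ c) r (x≤ , v) = ℕₚ.≤-trans x≤ (ℕₚ.≤-trans (ℕₚ.m≤m+n (length c) _) (ℕₚ.≤-reflexive (sym (Listₚ.length-++ c)))) , ++-zeros-valid c r v

∷-zeros-linked : ∀ x r → Linked _≥_ (x ∷ zeros r)
∷-zeros-linked x zero    = [-]
∷-zeros-linked x (suc r) = z≤n ∷ zeros-linked (suc r)

no-asc-linked : ∀ c r → firstAsc c ≡ nothing → Linked _≥_ (c ++ zeros r)
no-asc-linked []      r e = zeros-linked r
no-asc-linked (x ∷ c) r e = go x c e
  where
  go : ∀ x c → firstAsc (x ∷ c) ≡ nothing → Linked _≥_ (x ∷ c ++ zeros r)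
  go x []      e = ∷-zeros-linked x r
  go x (y ∷ c) e with x ≤ᵇ y in h
  ... | false with firstAsc (y ∷ c) in h'
  ...   | nothing = ℕₚ.<⇒≤ (≤ᵇ-false h) ∷ go y c h'

++-asc : ∀ {j c} d → Asc j c → Asc j (c ++ d) × op j (c ++ d) ≡ op j c ++ d
++-asc d (here p)  = here p , refl
++-asc d (there a) = there (proj₁ (++-asc d a)) , cong (_ ∷_) (proj₂ (++-asc d a))

-- The ascents used for c are also ascents of the padded code. When none is left, c is decreasing
-- and its padding is dominant, so both sides are the value of F on the same monomial.
⟦⟧-stable : ∀ {c} r {F} → Valid c → Ext F → ⟦ c ⟧ F ≡ ⟦ c ++ zeros r ⟧ F
⟦⟧-stable {c} r = go _ c (enough-tri c)
  where
  go : ∀ k c {F} → Enough k c → Valid c → Ext F → Sc k c F ≡ ⟦ c ++ zeros r ⟧ F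
  go zero    c e v ext = ⊥-elim (¬enough-zero c v e)
  go (suc k) c {F} e v ext with firstAsc c in h
  ... | nothing = trans (ext-≡ ext (≐-sym (++-replicate-0 c r))) (sym (⟦⟧-dominant (++-zeros-valid c r v) (no-asc-linked c r h) ext))
  ... | just i  = begin
    Sc k (op i c) (DD i F)              ≡⟨ go k (op i c) (enough-op a e) (op-valid a v) (DD-ext i ext) ⟩
    ⟦ op i c ++ zeros r ⟧ (DD i F)      ≡⟨ cong (λ c → ⟦ c ⟧ (DD i F)) (proj₂ (++-asc (zeros r) a)) ⟨
    ⟦ op i (c ++ zeros r) ⟧ (DD i F)    ≡⟨ ⟦⟧-step (++-zeros-valid c r v) ext (proj₁ (++-asc (zeros r) a)) ⟨
    ⟦ c ++ zeros r ⟧ F ∎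
    where
    open ≡-Reasoning
    a = firstAsc-Asc c h

-- Words and dual functionals

-- Word js t s: t arises from s by raising at the ascents js, last letter first.
data Word : List ℕ → List ℕ → List ℕ → Set where
  []  : ∀ {s} → Word [] s s
  _∷_ : ∀ {j js t s} → Asc j t → Word js t s → Word (j ∷ js) (op j t) s

φ : List ℕ → Functional → Functional
φ js F = foldr DD F js

φ-ext : ∀ js {F} → Ext F → Ext (φ js F)
φ-ext []       ext = ext
φ-ext (j ∷ js) ext = DD-ext j (φ-ext js ext)

word-valid : ∀ {js t s} → Word js t s → Valid s → Valid t
word-valid []      v = v
word-valid (a ∷ w) v = op-valid a (word-valid w v)

word-length : ∀ {js t s} → Word js t s → length t ≡ length s
word-length []      = refl
word-length (a ∷ w) = trans (length-op a) (word-length w)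

⟦⟧-word : ∀ {js t s F} → Valid s → Ext F → Word js t s → ⟦ s ⟧ F ≡ ⟦ t ⟧ (φ js F)
⟦⟧-word           v ext []      = refl
⟦⟧-word {j ∷ js} v ext (a ∷ w) = trans (⟦⟧-word v ext w) (⟦⟧-step (word-valid w v) (φ-ext js ext) a)

ε : Functional
ε []          = 1ℤ
ε (zero  ∷ m) = ε m
ε (suc _ ∷ m) = 0ℤ

ε-ext : Ext ε
ε-ext = mkExt (go _ _)
  where
  tail≐ : ∀ {x y a b} → (x ∷ a) ≐ (y ∷ b) → a ≐ b
  tail≐ e = mk≐ (λ i → at-≡ e (suc i))
  go : ∀ a b → a ≐ b → ε a ≡ ε b
  go []          []          e = refl
  go []          (zero ∷ b)  e = go [] b (mk≐ (λ i → at-≡ e (suc i)))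
  go []          (suc x ∷ b) e with () ← at-≡ e 0
  go (zero ∷ a)  []          e = go a [] (mk≐ (λ i → at-≡ e (suc i)))
  go (suc x ∷ a) []          e with () ← at-≡ e 0
  go (zero ∷ a)  (zero ∷ b)  e = go a b (tail≐ e)
  go (zero ∷ a)  (suc _ ∷ b) e with () ← at-≡ e 0
  go (suc _ ∷ a) (zero ∷ b)  e with () ← at-≡ e 0
  go (suc _ ∷ a) (suc _ ∷ b) e = refl

ε-zero : ∀ m → (∀ i → at m i ≡ 0) → ε m ≡ 1ℤ
ε-zero m z = ext-≡ ε-ext {m} {[]} (mk≐ z)

ε-pos : ∀ m i → at m i ≢ 0 → ε m ≡ 0ℤ
ε-pos []          i       p = ⊥-elim (p refl)
ε-pos (suc _ ∷ m) i       p = refl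
ε-pos (zero ∷ m)  zero    p = ⊥-elim (p refl)
ε-pos (zero ∷ m)  (suc i) p = ε-pos m i p

ε-degree : ∀ m → degree m ≢ 0 → ε m ≡ 0ℤ
ε-degree []          p = ⊥-elim (p refl)
ε-degree (zero ∷ m)  p = ε-degree m p
ε-degree (suc _ ∷ m) p = refl

degree-0 : ∀ c → degree c ≡ 0 → c ≡ zeros (length c)
degree-0 []         e = refl
degree-0 (zero ∷ c) e = cong (0 ∷_) (degree-0 c e)

-- If the code does not ascend at j, exchanging the two letters back yields the code it was raised
-- from. The code `t`, of the same length, certifies that both positions exist in `c`.
asc? : ∀ {j t} c → Asc j t → length c ≡ length t → Valid c →
       Asc j c ⊎ (∃[ c' ] Asc j c' × Valid c' × c ≡ op j c')
asc? (a ∷ b ∷ r) (here _) e (a≤ , b≤ , v) with a ℕ.≤? b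
asc? (a ∷ b ∷ r) (here _) e (a≤ , b≤ , v) | yes a≤b = inj₁ (here a≤b)
asc? (a ∷ b ∷ r) (here _) e (a≤ , b≤ , v) | no a≰b with ℕₚ.≰⇒> a≰b
asc? (suc a ∷ b ∷ r) (here _) e (s≤s a≤ , b≤ , v) | no _ | s≤s b≤a =
  inj₂ (b ∷ a ∷ r , here b≤a , (ℕₚ.m≤n⇒m≤1+n b≤ , a≤ , v) , refl)
asc? (x ∷ r) (there a) e (x≤ , v) with asc? r a (ℕₚ.suc-injective e) v
... | inj₁ a'                    = inj₁ (there a')
... | inj₂ (c' , a' , v' , refl) = inj₂ (x ∷ c' , there a' , (subst (x ≤_) (length-op a') x≤ , v') , refl)

⟦⟧-dual-≡ : ∀ {js t} n → Word js t (zeros n) → ⟦ t ⟧ (φ js ε) ≡ 1ℤ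
⟦⟧-dual-≡ n w = trans (sym (⟦⟧-word (zeros-valid n) ε-ext w))
  (trans (⟦⟧-dominant (zeros-valid n) (zeros-linked n) ε-ext) (ε-zero (zeros n) (at-replicate-0 n)))

-- The word is peeled off letter by letter: ∂_j kills 𝔖_c if c ascends at j and otherwise turns it
-- into 𝔖_c' with c = `op j c'`. When the word is used up, the code left is not zero, so its
-- polynomial has positive degree and no constant term.
⟦⟧-dual-≢ : ∀ {js t c n} → Word js t (zeros n) → Valid c → length c ≡ n → c ≢ t → ⟦ c ⟧ (φ js ε) ≡ 0ℤ
⟦⟧-dual-≢ {c = c} [] v refl c≢t = Sc-degree (suc (tri (length c))) c λ m d → ε-degree m λ d₀ → c≢t (degree-0 c (trans (sym d) d₀))
⟦⟧-dual-≢ {j ∷ js} {c = c} {n} (a ∷ w) v l c≢t with asc? c a (trans l (trans (sym (Listₚ.length-replicate n)) (sym (word-length w)))) v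
... | inj₁ a'                    = ⟦⟧-asc v (φ-ext js ε-ext) a'
... | inj₂ (c' , a' , v' , refl) = trans (sym (⟦⟧-step v' (φ-ext js ε-ext) a'))
  (⟦⟧-dual-≢ w v' (trans (sym (length-op a')) l) (c≢t ∘ cong (op j)))

-- Inversion counts and Lehmer codes of permutations

cnt : ℕ → List ℕ → ℕ
cnt x l = length (filter (λ y → y ℕ.<? x) l)

cnt-< : ∀ {x y} l → y < x → cnt x (y ∷ l) ≡ suc (cnt x l)
cnt-< {x} l y<x = cong length (Listₚ.filter-accept (λ y → y ℕ.<? x) y<x)

cnt-≮ : ∀ {x y} l → ¬ y < x → cnt x (y ∷ l) ≡ cnt x l
cnt-≮ {x} l y≮x = cong length (Listₚ.filter-reject (λ y → y ℕ.<? x) y≮x)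

cnt-∷-cong : ∀ x y {l l'} → cnt x l ≡ cnt x l' → cnt x (y ∷ l) ≡ cnt x (y ∷ l')
cnt-∷-cong x y {l} {l'} e with y ℕ.<? x
... | yes y<x = trans (cnt-< l y<x) (trans (cong suc e) (sym (cnt-< l' y<x)))
... | no  y≮x = trans (cnt-≮ l y≮x) (trans e (sym (cnt-≮ l' y≮x)))

cnt-swap : ∀ x y z l → cnt x (y ∷ z ∷ l) ≡ cnt x (z ∷ y ∷ l)
cnt-swap x y z l with y ℕ.<? x | z ℕ.<? x
... | yes p | yes q = trans (cnt-< (z ∷ l) p) (trans (cong suc (trans (cnt-< l q) (sym (cnt-< l p)))) (sym (cnt-< (y ∷ l) q)))
... | yes p | no q  = trans (cnt-< (z ∷ l) p) (trans (cong suc (cnt-≮ l q)) (sym (trans (cnt-≮ (y ∷ l) q) (cnt-< l p))))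
... | no p  | yes q = trans (cnt-≮ (z ∷ l) p) (trans (cnt-< l q) (sym (trans (cnt-< (y ∷ l) q) (cong suc (cnt-≮ l p)))))
... | no p  | no q  = trans (cnt-≮ (z ∷ l) p) (trans (cnt-≮ l q) (sym (trans (cnt-≮ (y ∷ l) q) (cnt-≮ l p))))

cnt-↭ : ∀ x {l l'} → l ↭ l' → cnt x l ≡ cnt x l'
cnt-↭ x Perm.refl                     = refl
cnt-↭ x (Perm.prep y p)               = cnt-∷-cong x y (cnt-↭ x p)
cnt-↭ x (Perm.swap {l} {l'} y z p)    = trans (cnt-∷-cong x y (cnt-∷-cong x z (cnt-↭ x p))) (cnt-swap x y z l')
cnt-↭ x (Perm.trans p q)              = trans (cnt-↭ x p) (cnt-↭ x q)

cnt-≤ : ∀ {x y} → x ≤ y → ∀ l → cnt x l ≤ cnt y l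
cnt-≤ x≤y []      = z≤n
cnt-≤ {x} {y} x≤y (z ∷ l) with z ℕ.<? x | z ℕ.<? y
... | yes p | yes q = subst₂ _≤_ (sym (cnt-< l p)) (sym (cnt-< l q)) (s≤s (cnt-≤ x≤y l))
... | yes p | no q  = ⊥-elim (q (ℕₚ.<-≤-trans p x≤y))
... | no p  | yes q = subst₂ _≤_ (sym (cnt-≮ l p)) (sym (cnt-< l q)) (ℕₚ.m≤n⇒m≤1+n (cnt-≤ x≤y l))
... | no p  | no q  = subst₂ _≤_ (sym (cnt-≮ l p)) (sym (cnt-≮ l q)) (cnt-≤ x≤y l)

cnt-strict : ∀ {x y} l → x < y → x ∈ l → cnt x l < cnt y l
cnt-strict {x} {y} (z ∷ l) x<y (here refl) = subst₂ _<_ (sym (cnt-≮ l (ℕₚ.<-irrefl refl))) (sym (cnt-< l x<y)) (s≤s (cnt-≤ (ℕₚ.<⇒≤ x<y) l))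
cnt-strict {x} {y} (z ∷ l) x<y (there i) with z ℕ.<? x | z ℕ.<? y
... | yes p | yes q = subst₂ _<_ (sym (cnt-< l p)) (sym (cnt-< l q)) (s≤s (cnt-strict l x<y i))
... | yes p | no q  = ⊥-elim (q (ℕₚ.<-trans p x<y))
... | no p  | yes q = subst₂ _<_ (sym (cnt-≮ l p)) (sym (cnt-< l q)) (ℕₚ.m<n⇒m<1+n (cnt-strict l x<y i))
... | no p  | no q  = subst₂ _<_ (sym (cnt-≮ l p)) (sym (cnt-≮ l q)) (cnt-strict l x<y i)

-- The first code entry also counts the letters of the whole list below the first letter. That count
-- depends only on the multiset and is strictly monotone on its letters, so it determines the first
-- letter.
lehmer-injective : ∀ {v w} → v ↭ w → lehmer v ≡ lehmer w → v ≡ w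
lehmer-injective {[]}    {[]}    p e = refl
lehmer-injective {[]}    {_ ∷ _} p e with () ← ↭-length p
lehmer-injective {_ ∷ _} {[]}    p e with () ← ↭-length p
lehmer-injective {x ∷ v} {y ∷ w} p e = helper (ℕₚ.<-cmp x y)
  where
  cnt-head : cnt x (y ∷ w) ≡ cnt y (y ∷ w)
  cnt-head = trans (sym (cnt-↭ x p)) (trans (cnt-≮ v (ℕₚ.<-irrefl refl))
    (trans (Listₚ.∷-injectiveˡ e) (sym (cnt-≮ w (ℕₚ.<-irrefl refl)))))
  helper : _ → x ∷ v ≡ y ∷ w
  helper (tri< x<y _ _)  = ⊥-elim (ℕₚ.<⇒≢ (cnt-strict (y ∷ w) x<y (∈-resp-↭ p (here refl))) cnt-head)
  helper (tri> _ _ y<x)  = ⊥-elim (ℕₚ.<⇒≢ (cnt-strict (y ∷ w) y<x (here refl)) (sym cnt-head))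
  helper (tri≈ _ refl _) = cong (x ∷_) (lehmer-injective (drop-∷ p) (Listₚ.∷-injectiveʳ e))

length-lehmer : ∀ w → length (lehmer w) ≡ length w
length-lehmer []      = refl
length-lehmer (x ∷ w) = cong suc (length-lehmer w)

lehmer-valid : ∀ w → Valid (lehmer w)
lehmer-valid []      = tt
lehmer-valid (x ∷ w) = subst (cnt x w ≤_) (sym (length-lehmer w)) (Listₚ.length-filter (λ y → y ℕ.<? x) w) , lehmer-valid w

<ᵇ-true : ∀ {a b} → a < b → (a <ᵇ b) ≡ true
<ᵇ-true a<b = Equivalence.to T-≡ (ℕₚ.<⇒<ᵇ a<b)

<ᵇ-false : ∀ {a b} → b ≤ a → (a <ᵇ b) ≡ false
<ᵇ-false {a} {b} b≤a with a <ᵇ b in h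
... | false = refl
... | true  = ⊥-elim (ℕₚ.<⇒≱ (ℕₚ.<ᵇ⇒< a b (Equivalence.from T-≡ h)) b≤a)

<⇒≤ᵇ-false : ∀ {a b} → b < a → (a ≤ᵇ b) ≡ false
<⇒≤ᵇ-false {a} {b} b<a with a ≤ᵇ b in h
... | false = refl
... | true  = ⊥-elim (ℕₚ.<⇒≱ b<a (≤ᵇ-true h))

cnt-asc : ∀ {x y} r → x < y → cnt x (y ∷ r) ≤ cnt y r
cnt-asc r x<y = subst (_≤ _) (sym (cnt-≮ r (ℕₚ.<⇒≯ x<y))) (cnt-≤ (ℕₚ.<⇒≤ x<y) r)

cnt-desc : ∀ {x y} r → y < x → cnt y r < cnt x (y ∷ r)
cnt-desc {x} {y} r y<x = subst (cnt y r <_) (sym (cnt-< r y<x)) (s≤s (cnt-≤ (ℕₚ.<⇒≤ y<x) r))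

firstAscent-lehmer : ∀ {w} → Unique w → firstAscent w ≡ firstAsc (lehmer w)
firstAscent-lehmer [] = refl
firstAscent-lehmer (_ ∷ []) = refl
firstAscent-lehmer {x ∷ y ∷ r} ((x≢y ∷ _) ∷ u) with ℕₚ.<-cmp x y
... | tri< x<y _ _  = trans (cong (if_then just 0 else Maybe.map suc (firstAscent (y ∷ r))) (<ᵇ-true x<y))
                        (sym (cong (if_then just 0 else Maybe.map suc (firstAsc (lehmer (y ∷ r)))) (Equivalence.to T-≡ (ℕₚ.≤⇒≤ᵇ (cnt-asc r x<y)))))
... | tri≈ _ x≡y _  = ⊥-elim (x≢y x≡y)
... | tri> _ _ y<x  = trans (cong (if_then just 0 else Maybe.map suc (firstAscent (y ∷ r))) (<ᵇ-false (ℕₚ.<⇒≤ y<x)))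
                        (trans (cong (Maybe.map suc) (firstAscent-lehmer u))
                        (sym (cong (if_then just 0 else Maybe.map suc (firstAsc (lehmer (y ∷ r)))) (<⇒≤ᵇ-false (cnt-desc r y<x)))))

swapAt-↭ : ∀ j w → swapAt j w ↭ w
swapAt-↭ zero    []          = ↭-refl
swapAt-↭ zero    (x ∷ [])    = ↭-refl
swapAt-↭ zero    (x ∷ y ∷ r) = Perm.swap y x ↭-refl
swapAt-↭ (suc j) []          = ↭-refl
swapAt-↭ (suc j) (x ∷ r)     = Perm.prep x (swapAt-↭ j r)

lehmer-swapAt : ∀ {j w} → Unique w → Asc j (lehmer w) → lehmer (swapAt j w) ≡ op j (lehmer w)
lehmer-swapAt {w = x ∷ y ∷ r} ((x≢y ∷ _) ∷ u) (here p) with ℕₚ.<-cmp x y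
... | tri< x<y _ _  = cong₂ _∷_ (cnt-< r x<y) (cong (_∷ lehmer r) (sym (cnt-≮ r (ℕₚ.<⇒≯ x<y))))
... | tri≈ _ x≡y _  = ⊥-elim (x≢y x≡y)
... | tri> _ _ y<x  = ⊥-elim (ℕₚ.<⇒≱ (cnt-desc r y<x) p)
lehmer-swapAt {suc j} {x ∷ r} (_ ∷ u) (there a) = cong₂ _∷_ (cnt-↭ x (swapAt-↭ j r)) (lehmer-swapAt u a)

cnt-w₀ : ∀ x n → n < x → cnt x (w₀ n) ≡ n
cnt-w₀ x zero    n<x = refl
cnt-w₀ x (suc n) n<x = trans (cnt-< (w₀ n) n<x) (cong suc (cnt-w₀ x n (ℕₚ.<-trans (ℕₚ.n<1+n n) n<x)))

lehmer-w₀ : ∀ n → lehmer (w₀ n) ≡ downFrom n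
lehmer-w₀ zero    = refl
lehmer-w₀ (suc n) = cong₂ _∷_ (cnt-w₀ (suc n) n (ℕₚ.n<1+n n)) (lehmer-w₀ n)

idPerm : ℕ → List ℕ
idPerm n = map suc (upTo n)

w₀-↭ : ∀ n → w₀ n ↭ idPerm n
w₀-↭ n = Permₚ.map⁺ suc (↭-trans (↭-reflexive (sym (Listₚ.reverse-upTo n))) (↭-reverse (upTo n)))

idPerm-sorted : ∀ n → AllPairs _<_ (idPerm n)
idPerm-sorted n = AllPairsₚ.map⁺ (AllPairsₚ.applyUpTo⁺₁ id n (λ i<j _ → s≤s i<j))

idPerm-unique : ∀ n → Unique (idPerm n)
idPerm-unique n = AllPairsₚ.map⁺ (AllPairsₚ.applyUpTo⁺₁ id n (λ i<j _ e → ℕₚ.<⇒≢ i<j (ℕₚ.suc-injective e)))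

unique-↭ : ∀ {v w : List ℕ} → v ↭ w → Unique v → Unique w
unique-↭ p = PermSetoidₚ.Unique-resp-↭ (setoid ℕ) (↭⇒↭ₛ p)

firstAsc-downFrom : ∀ n → firstAsc (downFrom n) ≡ nothing
firstAsc-downFrom zero          = refl
firstAsc-downFrom (suc zero)    = refl
firstAsc-downFrom (suc (suc n)) = trans
  (cong (if_then just 0 else Maybe.map suc (firstAsc (downFrom (suc n)))) (<⇒≤ᵇ-false (ℕₚ.n<1+n n)))
  (cong (Maybe.map suc) (firstAsc-downFrom (suc n)))

-- From the right, each entry exceeds the next and is bounded by the number of entries behind it,
-- which leaves one value.
no-asc-downFrom : ∀ c → Valid c → firstAsc c ≡ nothing → c ≡ downFrom (length c)
no-asc-downFrom []      v e = refl
no-asc-downFrom (x ∷ c) v e = go x c v e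
  where
  go : ∀ x c → Valid (x ∷ c) → firstAsc (x ∷ c) ≡ nothing → x ∷ c ≡ downFrom (suc (length c))
  go zero []      v e = refl
  go x    (y ∷ c) (x≤ , v) e with x ≤ᵇ y in h
  ... | false with firstAsc (y ∷ c) in h'
  ...   | nothing with go y c v h'
  ...     | e' = cong₂ _∷_ (ℕₚ.≤-antisym x≤ (subst (_< x) (Listₚ.∷-injectiveˡ e') (≤ᵇ-false h))) e'

-- Schubert polynomials through Lehmer codes

eval-single : ∀ F m → eval F ((+ 1 , m) ∷ []) ≡ F m
eval-single F m = trans (ℤₚ.+-identityʳ _) (ℤₚ.*-identityˡ (F m))

-- The fuel differs by one since `schubAux` recognises w₀ before it looks at the fuel, whereas `Sc`
-- spends a unit on finding no ascent.
eval-schubAux : ∀ F f n w → w ↭ idPerm n → eval F (schubAux f n w) ≡ Sc (suc f) (lehmer w) F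
eval-schubAux F f n w p with does (w ≟L w₀ n) in d
... | true with w ≟L w₀ n
...   | yes refl rewrite lehmer-w₀ n | firstAsc-downFrom n = eval-single F (downFrom n)
eval-schubAux F f n w p | false with firstAscent w in h | f
-- Without an ascent the code is that of w₀, against the failed test.
... | nothing | _ = ⊥-elim (not-w₀ (lehmer-injective (↭-trans p (↭-sym (w₀-↭ n))) (begin
  lehmer w                       ≡⟨ no-asc-downFrom (lehmer w) (lehmer-valid w) (trans (sym (firstAscent-lehmer (unique-↭ (↭-sym p) (idPerm-unique n)))) h) ⟩
  downFrom (length (lehmer w))   ≡⟨ cong downFrom (trans (length-lehmer w) (trans (↭-length p) (trans (Listₚ.length-map suc (upTo n)) (Listₚ.length-upTo n)))) ⟩
  downFrom n                     ≡⟨ lehmer-w₀ n ⟨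
  lehmer (w₀ n) ∎)))
  where
  open ≡-Reasoning
  not-w₀ : w ≢ w₀ n
  not-w₀ e with () ← trans (sym d) (dec-true (w ≟L w₀ n) e)
... | just i | zero rewrite trans (sym (firstAscent-lehmer (unique-↭ (↭-sym p) (idPerm-unique n)))) h = refl
... | just i | suc f' rewrite trans (sym (firstAscent-lehmer (unique-↭ (↭-sym p) (idPerm-unique n)))) h =
  trans (eval-∂ F i (schubAux f' n (swapAt i w))) (trans (eval-schubAux (DD i F) f' n (swapAt i w) (↭-trans (swapAt-↭ i w) p))
    (cong (λ c → Sc (suc f') c (DD i F)) (lehmer-swapAt u (firstAsc-Asc (lehmer w) (trans (sym (firstAscent-lehmer u)) h)))))
  where
  u = unique-↭ (↭-sym p) (idPerm-unique n)

tri≤ : ∀ n → tri n ≤ n ℕ.* n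
tri≤ zero    = z≤n
tri≤ (suc n) = ℕₚ.m≤n⇒m≤1+n (ℕₚ.+-monoʳ-≤ n (ℕₚ.≤-trans (tri≤ n) (ℕₚ.*-monoʳ-≤ n (ℕₚ.n≤1+n n))))

eval-𝔖 : ∀ F {w} → IsPerm w → eval F (𝔖 w) ≡ ⟦ lehmer w ⟧ F
eval-𝔖 F {w} p = trans (eval-schubAux F (L ℕ.* L) L w p)
  (trans (cong (λ k → Sc k (lehmer w) F) (sym fuel)) (Sc-+ (suc (tri (length (lehmer w)))) (L ℕ.* L ∸ tri L) (lehmer w) (lehmer-valid w) (enough-tri (lehmer w))))
  where
  L = length w
  fuel : (L ℕ.* L ∸ tri L) ℕ.+ suc (tri (length (lehmer w))) ≡ suc (L ℕ.* L)
  fuel = trans (ℕₚ.+-suc _ _) (cong suc (trans (cong (λ x → (L ℕ.* L ∸ tri L) ℕ.+ tri x) (length-lehmer w)) (ℕₚ.m∸n+n≡m (tri≤ L))))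

-- Padding by fixed points

cnt-++ : ∀ x l l' → cnt x (l ++ l') ≡ cnt x l ℕ.+ cnt x l'
cnt-++ x l l' = trans (cong length (Listₚ.filter-++ (λ y → y ℕ.<? x) l l')) (Listₚ.length-++ (filter _ l))

cnt-none : ∀ {x l} → All (x ≤_) l → cnt x l ≡ 0
cnt-none {x} a = cong length (Listₚ.filter-none (λ y → y ℕ.<? x) (All.map ℕₚ.≤⇒≯ a))

lehmer-++ : ∀ {v} w → All (λ x → All (x ≤_) v) w → lehmer (w ++ v) ≡ lehmer w ++ lehmer v
lehmer-++     []      []      = refl
lehmer-++ {v} (x ∷ w) (p ∷ a) = cong₂ _∷_ (trans (cnt-++ x w v) (trans (cong (cnt x w ℕ.+_) (cnt-none p)) (ℕₚ.+-identityʳ _))) (lehmer-++ w a)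

lehmer-sorted : ∀ {w} → AllPairs _<_ w → lehmer w ≡ zeros (length w)
lehmer-sorted []      = refl
lehmer-sorted (p ∷ a) = cong₂ _∷_ (cnt-none (All.map ℕₚ.<⇒≤ p)) (lehmer-sorted a)

isPerm-≤ : ∀ {w} → IsPerm w → All (_≤ length w) w
isPerm-≤ {w} p = All-resp-↭ (↭-sym p) (Allₚ.map⁺ (Allₚ.applyUpTo⁺₁ id (length w) (λ i< → i<)))

lehmer-padPerm : ∀ R {w} → IsPerm w → lehmer (padPerm R w) ≡ padZ R (lehmer w)
lehmer-padPerm R {w} p = trans (lehmer-++ w (All.map (λ x≤ → Allₚ.map⁺ (Allₚ.applyUpTo⁺₂ id m (λ i → ℕₚ.≤-trans x≤ (ℕₚ.m≤n⇒m≤1+n (ℕₚ.m≤m+n (length w) i))))) (isPerm-≤ p)))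
  (cong (lehmer w ++_) (trans (lehmer-sorted (AllPairsₚ.map⁺ (AllPairsₚ.applyUpTo⁺₁ id m (λ i<j _ → s≤s (ℕₚ.+-monoʳ-< (length w) i<j)))))
    (cong zeros (trans (Listₚ.length-map _ (upTo m)) (trans (Listₚ.length-upTo m) (cong (R ∸_) (sym (length-lehmer w))))))))
  where m = R ∸ length w

applyUpTo-+ : ∀ (f : ℕ → ℕ) a b → applyUpTo f (a ℕ.+ b) ≡ applyUpTo f a ++ applyUpTo (λ k → f (a ℕ.+ k)) b
applyUpTo-+ f zero    b = refl
applyUpTo-+ f (suc a) b = cong (f 0 ∷_) (applyUpTo-+ (f ∘ suc) a b)

padPerm-↭ : ∀ R {w} → length w ≤ R → IsPerm w → padPerm R w ↭ idPerm R
padPerm-↭ R {w} l p = ↭-trans (Permₚ.++⁺ʳ _ p) (↭-reflexive (begin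
  idPerm L ++ map (λ k → suc (L ℕ.+ k)) (upTo (R ∸ L))     ≡⟨ cong (idPerm L ++_) (Listₚ.map-upTo _ (R ∸ L)) ⟩
  idPerm L ++ applyUpTo (λ k → suc (L ℕ.+ k)) (R ∸ L)      ≡⟨ cong (_++ applyUpTo (λ k → suc (L ℕ.+ k)) (R ∸ L)) (Listₚ.map-upTo suc L) ⟩
  applyUpTo suc L ++ applyUpTo (λ k → suc (L ℕ.+ k)) (R ∸ L) ≡⟨ applyUpTo-+ suc L (R ∸ L) ⟨
  applyUpTo suc (L ℕ.+ (R ∸ L))                            ≡⟨ cong (applyUpTo suc) (ℕₚ.m+[n∸m]≡n l) ⟩
  applyUpTo suc R                                          ≡⟨ Listₚ.map-upTo suc R ⟨
  idPerm R ∎))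
  where
  open ≡-Reasoning
  L = length w

-- Permutations from Lehmer codes

length-removeAt : ∀ l {c} → c < length l → suc (length (removeAt l c)) ≡ length l
length-removeAt (x ∷ l)     {zero}  _       = refl
length-removeAt (x ∷ l)     {suc c} (s≤s p) = cong suc (length-removeAt l p)

removeAt-↭ : ∀ l {c} → c < length l → at l c ∷ removeAt l c ↭ l
removeAt-↭ (x ∷ l) {zero}  _       = ↭-refl
removeAt-↭ (x ∷ l) {suc c} (s≤s p) = ↭-trans (Perm.swap (at l c) x ↭-refl) (Perm.prep x (removeAt-↭ l p))

removeAt-All : ∀ {P : ℕ → Set} {l} c → All P l → All P (removeAt l c)
removeAt-All c       []      = []
removeAt-All zero    (p ∷ a) = a
removeAt-All (suc c) (p ∷ a) = p ∷ removeAt-All c a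

removeAt-sorted : ∀ {l} c → AllPairs _<_ l → AllPairs _<_ (removeAt l c)
removeAt-sorted c       []      = []
removeAt-sorted zero    (p ∷ a) = a
removeAt-sorted (suc c) (p ∷ a) = removeAt-All c p ∷ removeAt-sorted c a

at-All : ∀ {P : ℕ → Set} {l c} → c < length l → All P l → P (at l c)
at-All {c = zero}  _       (p ∷ a) = p
at-All {c = suc c} (s≤s q) (p ∷ a) = at-All q a

cnt-removeAt : ∀ {l c} → c < length l → AllPairs _<_ l → cnt (at l c) (removeAt l c) ≡ c
cnt-removeAt {c = zero}      _       (p ∷ a) = cnt-none (All.map ℕₚ.<⇒≤ p)
cnt-removeAt {x ∷ l} {suc c} (s≤s q) (p ∷ a) = trans (cnt-< (removeAt l c) (at-All q p)) (cong suc (cnt-removeAt q a))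

-- The remaining letters stay sorted, so the one at index c has exactly c smaller letters among
-- those still to be placed.
decode-spec : ∀ {l} cs → AllPairs _<_ l → length l ≡ length cs → Valid cs → decode l cs ↭ l × lehmer (decode l cs) ≡ cs
decode-spec {[]} []       s e v        = ↭-refl , refl
decode-spec {l}  (c ∷ cs) s e (c≤ , v) =
  ↭-trans (Perm.prep (at l c) (proj₁ ih)) (removeAt-↭ l c<) ,
  cong₂ _∷_ (trans (cnt-↭ (at l c) (proj₁ ih)) (cnt-removeAt c< s)) (proj₂ ih)
  where
  c< : c < length l
  c< = subst (c <_) (sym e) (s≤s c≤)
  ih = decode-spec {removeAt l c} cs (removeAt-sorted c s) (ℕₚ.suc-injective (trans (length-removeAt l c<) e)) v

fromLehmer-isPerm : ∀ {c} → Valid c → IsPerm (fromLehmer c)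
fromLehmer-isPerm {c} v = subst (λ n → fromLehmer c ↭ idPerm n) (sym (trans (↭-length p) (length-idPerm (length c)))) p
  where
  length-idPerm : ∀ n → length (idPerm n) ≡ n
  length-idPerm n = trans (Listₚ.length-map suc (upTo n)) (Listₚ.length-upTo n)
  p = proj₁ (decode-spec c (idPerm-sorted (length c)) (length-idPerm (length c)) v)

lehmer-fromLehmer : ∀ {c} → Valid c → lehmer (fromLehmer c) ≡ c
lehmer-fromLehmer {c} v = proj₂ (decode-spec c (idPerm-sorted (length c)) (trans (Listₚ.length-map suc (upTo (length c))) (Listₚ.length-upTo (length c))) v)

-- Extraction of a Schubert coefficient by a dual functional

module Dual {js w} (pw : IsPerm w) (word : ∀ r → Word js (lehmer w ++ zeros r) (zeros (length w ℕ.+ r))) where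

  -- Since t may be longer than w, both codes are padded to a common length R; `word` provides the
  -- same letters there, hence the same functional.
  eval-dual : ∀ {t} → IsPerm t → eval (φ js ε) (𝔖 t) ≡ (if samePerm t w then 1ℤ else 0ℤ)
  eval-dual {t} pt = trans (eval-𝔖 (φ js ε) pt) (trans (⟦⟧-stable (R ∸ length (lehmer t)) (lehmer-valid t) (φ-ext js ε-ext)) (compare (samePerm t w) refl))
    where
    R = length t ⊔ length w
    t≤R : length t ≤ R
    t≤R = ℕₚ.m≤m⊔n (length t) (length w)
    w≤R : length w ≤ R
    w≤R = ℕₚ.m≤n⊔m (length t) (length w)
    wordR : Word js (padZ R (lehmer w)) (zeros R)
    wordR = subst (λ n → Word js (padZ R (lehmer w)) (zeros n))
      (trans (cong (λ x → length w ℕ.+ (R ∸ x)) (length-lehmer w)) (ℕₚ.m+[n∸m]≡n w≤R)) (word (R ∸ length (lehmer w)))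
    compare : ∀ b → samePerm t w ≡ b → ⟦ padZ R (lehmer t) ⟧ (φ js ε) ≡ (if b then 1ℤ else 0ℤ)
    compare true  s with padPerm R t ≟L padPerm R w
    ... | yes e = trans (cong (λ c → ⟦ c ⟧ (φ js ε)) (trans (sym (lehmer-padPerm R pt)) (trans (cong lehmer e) (lehmer-padPerm R pw)))) (⟦⟧-dual-≡ R wordR)
    compare false s = ⟦⟧-dual-≢ wordR (++-zeros-valid (lehmer t) _ (lehmer-valid t))
      (length-padZ (lehmer t) (subst (_≤ R) (sym (length-lehmer t)) t≤R))
      λ e → distinct (lehmer-injective (↭-trans (padPerm-↭ R t≤R pt) (↭-sym (padPerm-↭ R w≤R pw)))
        (trans (lehmer-padPerm R pt) (trans e (sym (lehmer-padPerm R pw)))))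
      where
      distinct : padPerm R t ≢ padPerm R w
      distinct e with () ← trans (sym s) (dec-true (_ ≟L _) e)

  eval-expand : ∀ {E} → All (λ t → IsPerm (proj₂ t)) E → eval (φ js ε) (expand E) ≡ coeffAt E w
  eval-expand [] = refl
  eval-expand {(c , t) ∷ E} (pt ∷ a) = trans (eval-++ (φ js ε) (scaleP c (𝔖 t)) (expand E))
    (trans (cong₂ _⊕_ (trans (eval-scale (φ js ε) c (𝔖 t)) (cong (c ⊛_) (eval-dual pt))) (eval-expand a)) step)
    where
    step : c ⊛ (if samePerm t w then 1ℤ else 0ℤ) ⊕ coeffAt E w ≡ coeffAt ((c , t) ∷ E) w
    step with samePerm t w
    ... | true  = cong (_⊕ coeffAt E w) (ℤₚ.*-identityʳ c)
    ... | false = trans (cong (_⊕ coeffAt E w) (ℤₚ.*-zeroʳ c)) (ℤₚ.+-identityˡ _)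

  coeffAt-product : ∀ u v E → All (λ t → IsPerm (proj₂ t)) E → (𝔖 u *P 𝔖 v) ≈P expand E →
    coeffAt E w ≡ eval (λ m → eval (λ m' → φ js ε (addExp m m')) (𝔖 v)) (𝔖 u)
  coeffAt-product u v E a e = trans (sym (eval-expand a)) (trans (sym (eval-resp-≈P (φ-ext js ε-ext) {𝔖 u *P 𝔖 v} {expand E} e)) (eval-* (φ js ε) (𝔖 u) (𝔖 v)))

-- Words that carry an entry across zeros

range : ℕ → ℕ → List ℕ
range a zero    = []
range a (suc L) = a ∷ range (suc a) L

word-++ : ∀ {js ks t u s} → Word js t u → Word ks u s → Word (js ++ ks) t s
word-++ []      v = v
word-++ (a ∷ w) v = a ∷ word-++ w v

word-∷ : ∀ {a L t s} x → Word (range a L) t s → Word (range (suc a) L) (x ∷ t) (x ∷ s)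
word-∷ {L = zero}  x []      = []
word-∷ {L = suc L} x (a ∷ w) = there a ∷ word-∷ x w

-- Each exchange turns (0, x) into (x + 1, 0), so crossing l zeros adds l.
raise₀ : ∀ l x r → Word (range 0 l) (l ℕ.+ x ∷ zeros l ++ r) (zeros l ++ x ∷ r)
raise₀ zero    x r = []
raise₀ (suc l) x r = here z≤n ∷ word-∷ 0 (raise₀ l x r)

raise : ∀ P l x r → Word (range (length P) l) (P ++ l ℕ.+ x ∷ zeros l ++ r) (P ++ zeros l ++ x ∷ r)
raise []      l x r = raise₀ l x r
raise (y ∷ P) l x r = word-∷ y (raise P l x r)

-- Chains of divided differences

-- The divided differences at a, ..., a + L - 1 change exponents at the indices a, ..., a + L only.
record Agree (a L : ℕ) (m' m : Monomial) : Set where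
  constructor agree
  field
    below : ∀ i → i < a → at m' i ≡ at m i
    above : ∀ i → a ℕ.+ L < i → at m' i ≡ at m i
open Agree

agree-refl : ∀ {a L m} → Agree a L m m
agree-refl = agree (λ _ _ → refl) (λ _ _ → refl)

agree-set₂ : ∀ {a L m' m p q} → Agree (suc a) L m' (set₂ m a p q) → Agree a (suc L) m' m
agree-set₂ {a} {L} {m'} {m} {p} {q} g = agree
  (λ i i<a → trans (below g i (ℕₚ.m<n⇒m<1+n i<a)) (set₂-≢ m a p q i (ℕₚ.<⇒≢ i<a) (ℕₚ.<⇒≢ (ℕₚ.m<n⇒m<1+n i<a))))
  (λ i i> → trans (above g i (subst (_< i) (ℕₚ.+-suc a L) i>))
    (set₂-≢ m a p q i (ℕₚ.<⇒≢ (ℕₚ.≤-<-trans (ℕₚ.m≤m+n a (suc L)) i>) ∘ sym)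
      (ℕₚ.<⇒≢ (ℕₚ.≤-<-trans (ℕₚ.≤-trans (ℕₚ.m≤m+n (suc a) L) (ℕₚ.≤-reflexive (sym (ℕₚ.+-suc a L)))) i>) ∘ sym)))

chain-vanish : ∀ L a {G} m → (∀ m' → Agree a L m' m → G m' ≡ 0ℤ) → φ (range a L) G m ≡ 0ℤ
chain-vanish zero    a m v = v m agree-refl
chain-vanish (suc L) a m v = dd-vanish (at m a) (at m (suc a)) λ p q _ →
  chain-vanish L (suc a) (set₂ m a p q) (λ m' g → v m' (agree-set₂ g))

hh-first : ∀ a {f : ℕ → ℕ → ℤ} → (∀ p q → p ≢ 0 → f p q ≡ 0ℤ) → hh a f ≡ f 0 a
hh-first zero    v = refl
hh-first (suc a) {f} v = trans (hh-sucˡ a f) (trans (cong (f 0 (suc a) ⊕_) (hh-vanish a (λ p q _ → v (suc p) q λ ()))) (ℤₚ.+-identityʳ _))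

-- With both exponents positive, ∂ keeps the factor x_a x_{a+1}, and G kills everything containing
-- x_a.
DD-vanish-suc : ∀ {a k b G m} → (∀ p q → p ≢ 0 → G (set₂ m a p q) ≡ 0ℤ) →
                at m a ≡ suc k → at m (suc a) ≡ suc b → DD a G m ≡ 0ℤ
DD-vanish-suc {a} {k} {b} v e₁ e₂ rewrite e₁ | e₂ = dd-vanish k b (λ p q _ → v (suc p) (suc q) λ ())

-- The only term of h_k(x_a, x_{a+1}) free of x_a is x_{a+1}^k.
DD-move : ∀ {a k G m} → (∀ p q → p ≢ 0 → G (set₂ m a p q) ≡ 0ℤ) →
          at m a ≡ suc k → at m (suc a) ≡ 0 → DD a G m ≡ G (set₂ m a 0 k)
DD-move {a} {k} v e₁ e₂ rewrite e₁ | e₂ = hh-first k v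

-- Iterates `DD-move`: an exponent L + b crosses L places and arrives as b, because G kills every
-- monomial in which something is left behind.
chain-move : ∀ L a b {G} m → Ext G → at m a ≡ L ℕ.+ b → (∀ i → a < i → i ≤ a ℕ.+ L → at m i ≡ 0) →
  (∀ m' → Agree a L m' m → ∀ i → a ≤ i → i < a ℕ.+ L → at m' i ≢ 0 → G m' ≡ 0ℤ) →
  ∀ m₁ → Agree a L m₁ m → at m₁ (a ℕ.+ L) ≡ b → (∀ i → a ≤ i → i < a ℕ.+ L → at m₁ i ≡ 0) → φ (range a L) G m ≡ G m₁
chain-move zero a b {G} m ext e z v m₁ g e₁ z₁ = ext-≡ ext (mk≐ go)
  where
  go : ∀ i → at m i ≡ at m₁ i
  go i with ℕₚ.<-cmp i a
  ... | tri< i<a _ _  = sym (below g i i<a)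
  ... | tri≈ _ refl _ = trans e (sym (trans (cong (at m₁) (sym (ℕₚ.+-identityʳ a))) e₁))
  ... | tri> _ _ a<i  = sym (above g i (subst (_< i) (sym (ℕₚ.+-identityʳ a)) a<i))
chain-move (suc L) a b {G} m ext e z v m₁ g e₁ z₁ = trans
  (DD-move {G = φ (range (suc a) L) G} {m}
    (λ p q p≢0 → chain-vanish L (suc a) (set₂ m a p q) λ m' g' → v m' (agree-set₂ g') a ℕₚ.≤-refl (ℕₚ.m<m+n a (s≤s z≤n))
      (λ m'a → p≢0 (trans (sym (set₂-fst m a p q)) (trans (sym (below g' a ℕₚ.≤-refl)) m'a))))
    e (z (suc a) ℕₚ.≤-refl (ℕₚ.≤-trans (ℕₚ.m≤m+n (suc a) L) (ℕₚ.≤-reflexive (sym a+))) ))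
  (chain-move L (suc a) b (set₂ m a 0 (L ℕ.+ b)) ext (set₂-snd m a 0 (L ℕ.+ b))
    (λ i a<i i≤ → trans (set₂-≢ m a 0 _ i (ℕₚ.<⇒≢ (ℕₚ.<-trans (ℕₚ.n<1+n a) a<i) ∘ sym) (ℕₚ.<⇒≢ a<i ∘ sym))
       (z i (ℕₚ.<-trans (ℕₚ.n<1+n a) a<i) (subst (i ≤_) (sym a+) i≤)))
    (λ m' g' i a≤i i< → v m' (agree-set₂ g') i (ℕₚ.<⇒≤ a≤i) (subst (i <_) (sym a+) i<))
    m₁ (agree lower upper) (trans (cong (at m₁) (sym a+)) e₁) (λ i a≤i i< → z₁ i (ℕₚ.<⇒≤ a≤i) (subst (i <_) (sym a+) i<)))
  where
  a+ : a ℕ.+ suc L ≡ suc a ℕ.+ L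
  a+ = ℕₚ.+-suc a L
  lower : ∀ i → i < suc a → at m₁ i ≡ at (set₂ m a 0 (L ℕ.+ b)) i
  lower i (s≤s i≤a) with ℕₚ.m≤n⇒m<n∨m≡n i≤a
  ... | inj₁ i<a  = trans (below g i i<a) (sym (set₂-≢ m a 0 _ i (ℕₚ.<⇒≢ i<a) (ℕₚ.<⇒≢ (ℕₚ.m<n⇒m<1+n i<a))))
  ... | inj₂ refl = trans (z₁ a ℕₚ.≤-refl (ℕₚ.m<m+n a (s≤s z≤n))) (sym (set₂-fst m a 0 (L ℕ.+ b)))
  upper : ∀ i → suc a ℕ.+ L < i → at m₁ i ≡ at (set₂ m a 0 (L ℕ.+ b)) i
  upper i i> = trans (above g i (subst (_< i) (sym a+) i>))
    (sym (set₂-≢ m a 0 _ i (ℕₚ.<⇒≢ (ℕₚ.<-trans (ℕₚ.n<1+n a) a<i) ∘ sym) (ℕₚ.<⇒≢ a<i ∘ sym)))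
    where
    a<i : suc a < i
    a<i = ℕₚ.≤-<-trans (ℕₚ.m≤m+n (suc a) L) i>

chain-ε-pos : ∀ L a m i → i < a → at m i ≢ 0 → φ (range a L) ε m ≡ 0ℤ
chain-ε-pos L a m i i<a mi = chain-vanish L a m λ m' g → ε-pos m' i (mi ∘ trans (sym (below g i i<a)))

set₂-pos : ∀ L a m p q → p ≢ 0 → φ (range (suc a) L) ε (set₂ m a p q) ≡ 0ℤ
set₂-pos L a m p q p≢0 = chain-ε-pos L (suc a) (set₂ m a p q) a ℕₚ.≤-refl (p≢0 ∘ trans (sym (set₂-fst m a p q)))

-- The exponent either meets a nonzero neighbour and dies by `DD-vanish-suc`, or is used up at index
-- a + k. There the next exponent is zero as well, and ∂ kills the constant.
chain-ε-< : ∀ L a k m → at m a ≡ k → k < L → (∀ i → a ℕ.+ k < i → at m i ≡ 0) → φ (range a L) ε m ≡ 0ℤ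
chain-ε-< (suc L) a zero m e k<L z rewrite e | z (suc a) (s≤s (ℕₚ.≤-reflexive (ℕₚ.+-identityʳ a))) = refl
chain-ε-< (suc L) a (suc k) m e (s≤s k<L) z with at m (suc a) in e'
... | suc b = trans (cong (dd _ (at m a)) (sym e')) (DD-vanish-suc {G = φ (range (suc a) L) ε} {m} (set₂-pos L a m) e e')
... | zero  = trans (cong (dd _ (at m a)) (sym e')) (trans (DD-move {G = φ (range (suc a) L) ε} {m} (set₂-pos L a m) e e')
  (chain-ε-< L (suc a) k (set₂ m a 0 k) (set₂-snd m a 0 k) k<L λ i i> →
    trans (set₂-≢ m a 0 k i (ℕₚ.<⇒≢ (ℕₚ.≤-<-trans (ℕₚ.m≤m+n a (suc k)) (subst (_< i) (sym (ℕₚ.+-suc a k)) i>)) ∘ sym)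
            (ℕₚ.<⇒≢ (ℕₚ.≤-<-trans (ℕₚ.m≤m+n (suc a) k) i>) ∘ sym))
          (z i (subst (_< i) (sym (ℕₚ.+-suc a k)) i>))))

-- The L steps use up exactly the exponent at a. Another nonzero exponent is either met on the way,
-- which is fatal, or survives to the constant term.
chain-ε-≡ : ∀ L a m i → at m a ≡ L → a < i → at m i ≢ 0 → φ (range a L) ε m ≡ 0ℤ
chain-ε-≡ zero    a m i e a<i mi = ε-pos m i mi
chain-ε-≡ (suc L) a m i e a<i mi with at m (suc a) in e'
... | suc b = trans (cong (dd _ (at m a)) (sym e')) (DD-vanish-suc {G = φ (range (suc a) L) ε} {m} (set₂-pos L a m) e e')
... | zero  = trans (cong (dd _ (at m a)) (sym e')) (trans (DD-move {G = φ (range (suc a) L) ε} {m} (set₂-pos L a m) e e')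
  (chain-ε-≡ L (suc a) (set₂ m a 0 L) i (set₂-snd m a 0 L) 1+a<i
    (mi ∘ trans (sym (set₂-≢ m a 0 L i (ℕₚ.<⇒≢ a<i ∘ sym) (ℕₚ.<⇒≢ 1+a<i ∘ sym))))))
  where
  1+a<i : suc a < i
  1+a<i = ℕₚ.≤∧≢⇒< a<i λ { refl → mi e' }

at-addExp : ∀ m m' i → at (addExp m m') i ≡ at m i ℕ.+ at m' i
at-addExp []      m'       i       = refl
at-addExp (x ∷ m) []       i       = sym (ℕₚ.+-identityʳ _)
at-addExp (x ∷ m) (y ∷ m') zero    = refl
at-addExp (x ∷ m) (y ∷ m') (suc i) = at-addExp m m' i

addExp-cong : ∀ {a a' b b'} → a ≐ a' → b ≐ b' → addExp a b ≐ addExp a' b'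
addExp-cong {a} {a'} {b} {b'} e f = mk≐ λ i → trans (at-addExp a b i) (trans (cong₂ ℕ._+_ (at-≡ e i) (at-≡ f i)) (sym (at-addExp a' b' i)))

dd-shift : ∀ N f a b → dd f (N ℕ.+ a) (N ℕ.+ b) ≡ dd (λ p q → f (N ℕ.+ p) (N ℕ.+ q)) a b
dd-shift zero    f a b = refl
dd-shift (suc N) f a b = dd-shift N (λ p q → f (suc p) (suc q)) a b

hh-last : ∀ a {f : ℕ → ℕ → ℤ} → (∀ p q → p ℕ.+ q ≡ a → q ≢ 0 → f p q ≡ 0ℤ) → hh a f ≡ f a 0
hh-last zero    v = refl
hh-last (suc a) {f} v = trans (cong (f (suc a) 0 ⊕_) (hh-vanish a λ p q s → v p (suc q) (trans (ℕₚ.+-suc p q) (cong suc s)) λ ())) (ℤₚ.+-identityʳ _)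

zeros-+ : ∀ a b → zeros (a ℕ.+ b) ≡ zeros a ++ zeros b
zeros-+ zero    b = refl
zeros-+ (suc a) b = cong (0 ∷_) (zeros-+ a b)

-- Pairing the square with the dual functional

module Computation (N d s : ℕ) (d<N : d < N) (N≤s : N ≤ s) where

  uCode : List ℕ
  uCode = N ∷ zeros d ++ N ∷ zeros s

  top : ℕ → ℕ → Monomial
  top p q = N ℕ.+ p ∷ N ℕ.+ q ∷ zeros d ++ zeros s

  -- 𝔖_u = Σ_{p+q=d} x₁^{N+p} h_{N+q−d}(x₂, …, x_{d+2})
  U : Functional → ℤ
  U F = hh d (λ p q → φ (range 1 d) F (top p q))

  uCode-valid : Valid uCode
  uCode-valid = subst (N ≤_) (sym (Listₚ.length-++ (zeros d))) (ℕₚ.≤-trans N≤s (ℕₚ.≤-trans (ℕₚ.n≤1+n s)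
      (ℕₚ.≤-trans (ℕₚ.≤-reflexive (cong suc (sym (Listₚ.length-replicate s)))) (ℕₚ.m≤n+m _ (length (zeros d))))))
    , tail d
    where
    tail : ∀ d → Valid (zeros d ++ N ∷ zeros s)
    tail zero    = subst (N ≤_) (sym (Listₚ.length-replicate s)) N≤s , zeros-valid s
    tail (suc d) = z≤n , tail d

  ⟦uCode⟧ : ∀ {F} → Ext F → ⟦ uCode ⟧ F ≡ U F
  ⟦uCode⟧ {F} ext = begin
    ⟦ uCode ⟧ F
      ≡⟨ ⟦⟧-word uCode-valid ext word ⟩
    ⟦ dominant ⟧ (φ (0 ∷ range 1 d) F)
      ≡⟨ ⟦⟧-dominant (word-valid word uCode-valid) linked (φ-ext (0 ∷ range 1 d) ext) ⟩
    dd f (suc (d ℕ.+ N)) N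
      -- In ∂₁ of x₁^(N+d+1) x₂^N the symmetric factor (x₁x₂)^N comes out, and ∂₁ x₁^(d+1) = h_d(x₁,
      -- x₂) is the sum over p + q = d.
      ≡⟨ cong₂ (dd f) (trans (cong suc (ℕₚ.+-comm d N)) (sym (ℕₚ.+-suc N d))) (sym (ℕₚ.+-identityʳ N)) ⟩
    dd f (N ℕ.+ suc d) (N ℕ.+ 0)
      ≡⟨ dd-shift N f (suc d) 0 ⟩
    U F ∎
    where
    open ≡-Reasoning
    dominant = suc (d ℕ.+ N) ∷ N ∷ zeros d ++ zeros s
    f : ℕ → ℕ → ℤ
    f p q = φ (range 1 d) F (p ∷ q ∷ zeros d ++ zeros s)
    word : Word (0 ∷ range 1 d) dominant uCode
    word = here (ℕₚ.m≤n+m N d) ∷ word-∷ N (raise₀ d N (zeros s))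
    linked : Linked _≥_ dominant
    linked = ℕₚ.≤-trans (ℕₚ.m≤n+m N d) (ℕₚ.n≤1+n _) ∷ subst (λ z → Linked _≥_ (N ∷ z)) (zeros-+ d s) (∷-zeros-linked N (d ℕ.+ s))

  U-cong : ∀ {F G} → (∀ m → F m ≡ G m) → U F ≡ U G
  U-cong {F} {G} e = hh-cong d λ p q _ → go (range 1 d) (top p q)
    where
    go : ∀ js m → φ js F m ≡ φ js G m
    go []       m = e m
    go (j ∷ js) m = DD-cong j (go js) m

  -- What the estimates use about the monomials of the summand p: the power of x₁, and that no
  -- variable beyond x_{d+2} occurs.
  Shape : ℕ → Monomial → Set
  Shape p m = at m 0 ≡ N ℕ.+ p × (∀ i → suc d < i → at m i ≡ 0)

  top-zero : ∀ p q i → 1 < i → at (top p q) i ≡ 0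
  top-zero p q (suc (suc i)) _ = trans (cong (λ z → at z i) (sym (zeros-+ d s))) (at-replicate-0 (d ℕ.+ s) i)
  top-zero p q (suc zero) (s≤s ())

  agree-shape : ∀ {p q m} → Agree 1 d m (top p q) → Shape p m
  agree-shape {p} {q} g = below g 0 (s≤s z≤n) , λ i i> → trans (above g i i>) (top-zero p q i (ℕₚ.≤-<-trans (s≤s z≤n) i>))

  U-vanish : ∀ {F} → (∀ p q → p ℕ.+ q ≡ d → ∀ m → Shape p m → F m ≡ 0ℤ) → U F ≡ 0ℤ
  U-vanish v = hh-vanish d λ p q pq → chain-vanish d 1 (top p q) λ m g → v p q pq m (agree-shape g)

  -- The first code entry of N*w, in the form in which `dilate` produces it.
  K : ℕ
  K = N ℕ.* 3

  K≡ : K ≡ N ℕ.+ (N ℕ.+ N)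
  K≡ = trans (ℕₚ.*-comm N 3) (cong (λ x → N ℕ.+ (N ℕ.+ x)) (ℕₚ.+-identityʳ N))

  -- Read from the right: a 0 crosses K zeros and becomes the first entry K, then another crosses N
  -- zeros and becomes the entry N at index d + 1.
  wWord : List ℕ
  wWord = range (suc d) N ++ range 0 K

  Ψ Φ : Functional
  Ψ = φ (range 0 K) ε
  Φ = φ wWord ε

  Φ-chain : ∀ m → Φ m ≡ φ (range (suc d) N) Ψ m
  Φ-chain m = cong (λ F → F m) (Listₚ.foldr-++ DD ε (range (suc d) N) (range 0 K))

  -- The chain applied first touches the indices d + 1, ..., d + 1 + N only. All of them are at most
  -- k, so beyond index k the exponents remain zero, as `chain-ε-<` requires.
  Φ-< : ∀ m k → at m 0 ≡ k → suc d ℕ.+ N ≤ k → k < K → (∀ i → suc d < i → at m i ≡ 0) → Φ m ≡ 0ℤ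
  Φ-< m k e k≥ k<K z = trans (Φ-chain m) (chain-vanish N (suc d) m λ m' g →
    chain-ε-< K 0 k m' (trans (below g 0 (s≤s z≤n)) e) k<K λ i i> →
      trans (above g i (ℕₚ.≤-<-trans k≥ i>)) (z i (ℕₚ.≤-<-trans (ℕₚ.≤-trans (ℕₚ.m≤m+n (suc d) N) k≥) i>)))

  Φ-≡ : ∀ m i → at m 0 ≡ K → 0 < i → i ≤ d → at m i ≢ 0 → Φ m ≡ 0ℤ
  Φ-≡ m i e 0<i i≤d mi = trans (Φ-chain m) (chain-vanish N (suc d) m λ m' g →
    chain-ε-≡ K 0 m' i (trans (below g 0 (s≤s z≤n)) e) 0<i (mi ∘ trans (sym (below g i (s≤s i≤d)))))

  Φ-one : ∀ m → at m 0 ≡ K → at m (suc d) ≡ N → (∀ i → 0 < i → i ≢ suc d → at m i ≡ 0) → Φ m ≡ 1ℤ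
  Φ-one m e₀ e₁ z = begin
    Φ m                        ≡⟨ Φ-chain m ⟩
    φ (range (suc d) N) Ψ m    ≡⟨ chain-move N (suc d) 0 m (φ-ext (range 0 K) ε-ext) (trans e₁ (sym (ℕₚ.+-identityʳ N)))
                                    (λ i d<i _ → z i (ℕₚ.≤-<-trans z≤n d<i) (ℕₚ.<⇒≢ d<i ∘ sym))
                                    (λ m' g i d<i _ mi → chain-ε-≡ K 0 m' i (trans (below g 0 (s≤s z≤n)) e₀) (ℕₚ.<-≤-trans (s≤s z≤n) d<i) mi)
                                    -- The N steps of the first chain use up x_{d+2}^N and leave
                                    -- x₁^K.
                                    (K ∷ []) (agree lower (λ { (suc i) i> → sym (z (suc i) (s≤s z≤n) (ℕₚ.<⇒≢ (ℕₚ.≤-<-trans (ℕₚ.m≤m+n (suc d) N) i>) ∘ sym)) }))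
                                    refl (λ { (suc i) _ _ → refl }) ⟩
    Ψ (K ∷ [])                 ≡⟨ chain-move K 0 0 (K ∷ []) ε-ext (sym (ℕₚ.+-identityʳ K)) (λ { (suc i) _ _ → refl }) (λ m' _ i _ _ → ε-pos m' i)
                                    [] (agree (λ _ ()) (λ { (suc i) _ → refl })) refl (λ _ _ _ → refl) ⟩
    1ℤ ∎
    where
    open ≡-Reasoning
    lower : ∀ i → i < suc d → at (K ∷ []) i ≡ at m i
    lower zero    _   = sym e₀
    lower (suc i) i<d = sym (z (suc i) (s≤s z≤n) (ℕₚ.<⇒≢ i<d))

  T : Monomial → Functional
  T m m' = Φ (addExp m m')

  T-ext : ∀ m → Ext (T m)
  T-ext m = mkExt λ e → ext-≡ (φ-ext wWord ε-ext) (addExp-cong {m} ≐-refl e)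

  UT-ext : Ext (λ m → U (T m))
  UT-ext = mkExt λ e → U-cong λ m' → ext-≡ (φ-ext wWord ε-ext) (addExp-cong e (≐-refl {m'}))

  head-sum : ∀ {p p' m m'} → Shape p m → Shape p' m' → at (addExp m m') 0 ≡ (N ℕ.+ p) ℕ.+ (N ℕ.+ p')
  head-sum {m = m} {m'} σ σ' = trans (at-addExp m m' 0) (cong₂ ℕ._+_ (proj₁ σ) (proj₁ σ'))

  interchange : ∀ a b → (N ℕ.+ a) ℕ.+ (N ℕ.+ b) ≡ N ℕ.+ (N ℕ.+ (a ℕ.+ b))
  interchange a b = trans (ℕₚ.+-assoc N a _) (cong (N ℕ.+_) (trans (sym (ℕₚ.+-assoc a N b)) (trans (cong (ℕ._+ b) (ℕₚ.+-comm a N)) (ℕₚ.+-assoc N a b))))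

  T-< : ∀ {p p' m m'} → Shape p m → Shape p' m' → p ℕ.+ p' < N → T m m' ≡ 0ℤ
  T-< {p} {p'} {m} {m'} σ σ' p+p'<N = Φ-< (addExp m m') _ (head-sum {m = m} {m'} σ σ')
    -- The exponent of x₁ is at least 2N, hence at least d + 1 + N.
    (ℕₚ.+-mono-≤ (ℕₚ.≤-trans d<N (ℕₚ.m≤m+n N p)) (ℕₚ.m≤m+n N p'))
    (subst₂ _<_ (sym (interchange p p')) (sym K≡) (ℕₚ.+-monoʳ-< N (ℕₚ.+-monoʳ-< N p+p'<N)))
    (λ i i> → trans (at-addExp m m' i) (cong₂ ℕ._+_ (proj₂ σ i i>) (proj₂ σ' i i>)))

  UUT-zero : d ℕ.+ d < N → U (λ m → U (T m)) ≡ 0ℤ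
  UUT-zero 2d<N = U-vanish λ p q pq m σ → U-vanish λ p' q' pq' m' σ' →
    T-< {m = m} {m'} σ σ' (ℕₚ.≤-<-trans (ℕₚ.+-mono-≤ (ℕₚ.m+n≤o⇒m≤o p (ℕₚ.≤-reflexive pq)) (ℕₚ.m+n≤o⇒m≤o p' (ℕₚ.≤-reflexive pq'))) 2d<N)

  module Extremal (N≡2d : N ≡ d ℕ.+ d) where

    -- For N = 2d the summand p = d is x₁^(N+d) h_d(x₂, ..., x_{d+2}). This is its term in x₁ and
    -- x_{d+2} alone, whose square is x₁^(3N) x_{d+2}^N.
    peak : Monomial
    peak = N ℕ.+ d ∷ zeros d ++ d ∷ []

    at-peak : at peak (suc d) ≡ d
    at-peak = go d
      where
      go : ∀ k → at (zeros k ++ d ∷ []) k ≡ d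
      go zero    = refl
      go (suc k) = go k

    peak-zero : ∀ i → 0 < i → i ≢ suc d → at peak i ≡ 0
    peak-zero (suc i) _ i≢ = go d i (i≢ ∘ cong suc)
      where
      go : ∀ k i → i ≢ k → at (zeros k ++ d ∷ []) i ≡ 0
      go zero    zero    i≢ = ⊥-elim (i≢ refl)
      go zero    (suc i) i≢ = refl
      go (suc k) zero    i≢ = refl
      go (suc k) (suc i) i≢ = go k i (i≢ ∘ cong suc)

    peak-shape : Shape d peak
    peak-shape = refl , λ i i> → peak-zero i (ℕₚ.≤-<-trans z≤n i>) (ℕₚ.<⇒≢ i> ∘ sym)

    U-peak : ∀ {F} → Ext F →
      (∀ p → p < d → ∀ m → Shape p m → F m ≡ 0ℤ) →
      (∀ m → Shape d m → ∀ i → 0 < i → i ≤ d → at m i ≢ 0 → F m ≡ 0ℤ) → U F ≡ F peak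
    U-peak ext v v' = trans
      (hh-last d λ p q pq q≢0 → chain-vanish d 1 (top p q) λ m g →
        v p (subst (p <_) pq (ℕₚ.m<m+n p (ℕₚ.n≢0⇒n>0 q≢0))) m (agree-shape g))
      -- The exponent N = d + d at index 1 loses d on its way to index d + 1.
      (chain-move d 1 d (top d 0) ext (trans (ℕₚ.+-identityʳ N) N≡2d) (λ i i> _ → top-zero d 0 i i>)
        (λ m g i 0<i i< mi → v' m (agree-shape g) i 0<i (ℕₚ.≤-pred i<) mi)
        peak (agree (λ { zero _ → refl ; (suc i) (s≤s ()) }) (λ i i> → trans (proj₂ peak-shape i i>) (sym (top-zero d 0 i (ℕₚ.≤-<-trans (s≤s z≤n) i>)))))
        at-peak (λ i 0<i i< → peak-zero i 0<i (ℕₚ.<⇒≢ i<)))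

    d+d≡ : (N ℕ.+ d) ℕ.+ (N ℕ.+ d) ≡ K
    d+d≡ = trans (interchange d d) (trans (cong (λ x → N ℕ.+ (N ℕ.+ x)) (sym N≡2d)) (sym K≡))

    T-extremal : ∀ {m m'} → Shape d m → Shape d m' → ∀ i → 0 < i → i ≤ d → at m i ℕ.+ at m' i ≢ 0 → T m m' ≡ 0ℤ
    T-extremal {m} {m'} σ σ' i 0<i i≤d p = Φ-≡ (addExp m m') i (trans (head-sum {m = m} {m'} σ σ') d+d≡) 0<i i≤d (p ∘ trans (sym (at-addExp m m' i)))

    UUT-one : U (λ m → U (T m)) ≡ 1ℤ
    UUT-one = trans (U-peak UT-ext
        (λ p p<d m σ → U-vanish λ p' q' pq' m' σ' → T-< {m = m} {m'} σ σ'
          (subst (p ℕ.+ p' <_) (sym N≡2d) (ℕₚ.+-mono-<-≤ p<d (ℕₚ.m+n≤o⇒m≤o p' (ℕₚ.≤-reflexive pq')))))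
        (λ m σ i 0<i i≤d mi → U-vanish λ p' q' pq' m' σ' → inner m σ i 0<i i≤d mi p' (ℕₚ.m+n≤o⇒m≤o p' (ℕₚ.≤-reflexive pq')) m' σ'))
      (trans (U-peak (T-ext peak)
        (λ p p<d m' σ' → T-< {m = peak} {m'} peak-shape σ' (subst (d ℕ.+ p <_) (sym N≡2d) (ℕₚ.+-monoʳ-< d p<d)))
        (λ m' σ' i 0<i i≤d mi → T-extremal {peak} {m'} peak-shape σ' i 0<i i≤d (mi ∘ ℕₚ.m+n≡0⇒n≡0 (at peak i))))
      (Φ-one (addExp peak peak) (trans (head-sum {m = peak} {peak} peak-shape peak-shape) d+d≡)
        (trans (at-addExp peak peak (suc d)) (trans (cong₂ ℕ._+_ at-peak at-peak) (sym N≡2d)))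
        (λ i 0<i i≢ → trans (at-addExp peak peak i) (cong₂ ℕ._+_ (peak-zero i 0<i i≢) (peak-zero i 0<i i≢)))))
      where
      -- If p' < d the power of x₁ stays below 3N; if p' = d it equals 3N and the variable at index
      -- i is fatal.
      inner : ∀ m → Shape d m → ∀ i → 0 < i → i ≤ d → at m i ≢ 0 → ∀ p' → p' ≤ d → ∀ m' → Shape p' m' → T m m' ≡ 0ℤ
      inner m σ i 0<i i≤d mi p' p'≤d m' σ' with ℕₚ.m≤n⇒m<n∨m≡n p'≤d
      ... | inj₁ p'<d = T-< {m = m} {m'} σ σ' (subst (d ℕ.+ p' <_) (sym N≡2d) (ℕₚ.+-monoʳ-< d p'<d))
      ... | inj₂ refl = T-extremal {m} {m'} σ σ' i 0<i i≤d (mi ∘ ℕₚ.m+n≡0⇒m≡0 (at m i))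

-- Lehmer codes of the given permutations and their dilations

module _ (k l : ℕ) where

  -- The tail of both permutations: k = 3 for u and k = 5 for w.
  endSwap : List ℕ
  endSwap = map (k ℕ.+_) (upTo l) ++ suc (k ℕ.+ l) ∷ k ℕ.+ l ∷ []

  endSwap-≥ : ∀ {x} → x ≤ k → All (x ≤_) endSwap
  endSwap-≥ x≤k = Allₚ.++⁺ (Allₚ.map⁺ (Allₚ.applyUpTo⁺₂ id l (λ i → ℕₚ.≤-trans x≤k (ℕₚ.m≤m+n k i))))
    (ℕₚ.m≤n⇒m≤1+n (ℕₚ.≤-trans x≤k (ℕₚ.m≤m+n k l)) ∷ ℕₚ.≤-trans x≤k (ℕₚ.m≤m+n k l) ∷ [])

  lehmer-endSwap : lehmer endSwap ≡ zeros l ++ 1 ∷ 0 ∷ []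
  lehmer-endSwap = trans
    (lehmer-++ _ (Allₚ.map⁺ (Allₚ.applyUpTo⁺₁ id l λ i<l → ℕₚ.m≤n⇒m≤1+n (ℕₚ.+-monoʳ-≤ k (ℕₚ.<⇒≤ i<l)) ∷ ℕₚ.+-monoʳ-≤ k (ℕₚ.<⇒≤ i<l) ∷ [])))
    (cong₂ _++_
      (trans (lehmer-sorted (AllPairsₚ.map⁺ (AllPairsₚ.applyUpTo⁺₁ id l λ i<j _ → ℕₚ.+-monoʳ-< k i<j)))
             (cong zeros (trans (Listₚ.length-map (k ℕ.+_) (upTo l)) (Listₚ.length-upTo l))))
      (cong (_∷ 0 ∷ []) (cnt-< [] (ℕₚ.n<1+n (k ℕ.+ l)))))

lehmer-uPerm : ∀ e → lehmer (uPerm (7 ℕ.+ e)) ≡ 1 ∷ zeros (4 ℕ.+ e) ++ 1 ∷ 0 ∷ []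
lehmer-uPerm e = cong₂ _∷_
  (trans (cnt-< {2} {1} end (s≤s (s≤s z≤n))) (cong suc (cnt-none {2} {end} (≥end (s≤s (s≤s z≤n))))))
  (cong₂ _∷_ (cnt-none {1} {end} (≥end (s≤s z≤n))) (lehmer-endSwap 3 (3 ℕ.+ e)))
  where
  end = endSwap 3 (3 ℕ.+ e)
  ≥end : ∀ {x} → x ≤ 3 → All (x ≤_) end
  ≥end = endSwap-≥ 3 (3 ℕ.+ e)

lehmer-wPerm : ∀ e → lehmer (wPerm (7 ℕ.+ e)) ≡ 3 ∷ zeros (4 ℕ.+ e) ++ 1 ∷ 0 ∷ []
lehmer-wPerm e = cong₂ _∷_
  (trans (cnt-< {4} {1} (2 ∷ 3 ∷ end) (s≤s (s≤s z≤n))) (cong suc (trans (cnt-< {4} {2} (3 ∷ end) (s≤s (s≤s (s≤s z≤n)))) (cong suc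
    (trans (cnt-< {4} {3} end (s≤s (s≤s (s≤s (s≤s z≤n))))) (cong suc (cnt-none {4} {end} (≥end (s≤s (s≤s (s≤s (s≤s z≤n))))))))))))
  (cong₂ _∷_ (cnt-none {1} {2 ∷ 3 ∷ end} (s≤s z≤n ∷ s≤s z≤n ∷ ≥end (s≤s z≤n)))
  (cong₂ _∷_ (cnt-none {2} {3 ∷ end} (s≤s (s≤s z≤n) ∷ ≥end (s≤s (s≤s z≤n))))
  (cong₂ _∷_ (cnt-none {3} {end} (≥end (s≤s (s≤s (s≤s z≤n))))) (lehmer-endSwap 5 (suc e)))))
  where
  end = endSwap 5 (suc e)
  ≥end : ∀ {x} → x ≤ 5 → All (x ≤_) end
  ≥end = endSwap-≥ 5 (suc e)

-- The final 0 of the code joins the padding, which accounts for the `suc`; 3 + d is the length n of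
-- w.
dilate : ∀ N {w x d} → lehmer w ≡ x ∷ zeros d ++ 1 ∷ 0 ∷ [] →
  map (N *_) (lehmer w) ++ zeros (N * length w ∸ length w) ≡ N * x ∷ zeros d ++ N ∷ zeros (suc (N * (3 ℕ.+ d) ∸ (3 ℕ.+ d)))
dilate N {w} {x} {d} e = begin
  map (N *_) (lehmer w) ++ zeros (N * length w ∸ length w)
    ≡⟨ cong₂ (λ c n → map (N *_) c ++ zeros (N * n ∸ n)) e len ⟩
  N * x ∷ map (N *_) (zeros d ++ 1 ∷ 0 ∷ []) ++ z
    ≡⟨ cong (λ c → N * x ∷ c ++ z) (Listₚ.map-++ (N *_) (zeros d) (1 ∷ 0 ∷ [])) ⟩
  N * x ∷ (map (N *_) (zeros d) ++ N * 1 ∷ N * 0 ∷ []) ++ z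
    ≡⟨ cong (N * x ∷_) (Listₚ.++-assoc (map (N *_) (zeros d)) _ z) ⟩
  N * x ∷ map (N *_) (zeros d) ++ N * 1 ∷ N * 0 ∷ z
    ≡⟨ cong₂ (λ c y → N * x ∷ c ++ y) (trans (Listₚ.map-replicate (N *_) d 0) (cong (replicate d) (ℕₚ.*-zeroʳ N)))
         (cong₂ (λ a b → a ∷ b ∷ z) (ℕₚ.*-identityʳ N) (ℕₚ.*-zeroʳ N)) ⟩
  N * x ∷ zeros d ++ N ∷ 0 ∷ z ∎
  where
  open ≡-Reasoning
  z = zeros (N * (3 ℕ.+ d) ∸ (3 ℕ.+ d))
  len : length w ≡ 3 ℕ.+ d
  len = trans (sym (length-lehmer w)) (trans (cong length e) (cong suc
    (trans (Listₚ.length-++ (zeros d)) (trans (cong (ℕ._+ 2) (Listₚ.length-replicate d)) (ℕₚ.+-comm d 2)))))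

-- The coefficient of the dilated permutations

module Dilated (e N : ℕ) (2d≤N : (4 ℕ.+ e) ℕ.+ (4 ℕ.+ e) ≤ N) where

  d X s : ℕ
  d = 4 ℕ.+ e
  X = N * (3 ℕ.+ d)
  s = suc (X ∸ (3 ℕ.+ d))

  d<N : d < N
  d<N = ℕₚ.<-≤-trans (ℕₚ.m<m+n d (s≤s z≤n)) 2d≤N

  3+d≤N : 3 ℕ.+ d ≤ N
  3+d≤N = ℕₚ.≤-trans (ℕₚ.+-monoˡ-≤ d {3} {d} (s≤s (s≤s (s≤s z≤n)))) 2d≤N

  X≡ : X ≡ N * 3 ℕ.+ N * d
  X≡ = ℕₚ.*-distribˡ-+ N 3 d

  N+N≤X : N ℕ.+ N ≤ X
  N+N≤X = ℕₚ.≤-trans (ℕₚ.≤-trans (ℕₚ.+-monoʳ-≤ N (ℕₚ.m≤m+n N (N ℕ.+ 0)))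
    (ℕₚ.≤-reflexive (ℕₚ.*-comm 3 N))) (ℕₚ.≤-trans (ℕₚ.m≤m+n (N * 3) (N * d)) (ℕₚ.≤-reflexive (sym X≡)))

  N≤s : N ≤ s
  N≤s = ℕₚ.m≤n⇒m≤1+n (ℕₚ.m+n≤o⇒m≤o∸n N (ℕₚ.≤-trans (ℕₚ.+-monoʳ-≤ N 3+d≤N) N+N≤X))

  open Computation N d s d<N N≤s

  suc-d+s : suc (suc (d ℕ.+ s)) ≡ X
  suc-d+s = trans (cong (suc ∘ suc) (ℕₚ.+-suc d _)) (ℕₚ.m+[n∸m]≡n (ℕₚ.≤-trans 3+d≤N (ℕₚ.≤-trans (ℕₚ.m≤m+n N N) N+N≤X)))

  K<X : K < X
  K<X = subst (K <_) (sym X≡) (ℕₚ.m<m+n K (ℕₚ.*-mono-≤ {1} {N} {1} {d} (ℕₚ.≤-trans (s≤s z≤n) d<N) (s≤s z≤n)))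

  wCode : List ℕ
  wCode = K ∷ zeros d ++ N ∷ zeros s

  wCode-word : ∀ r → Word wWord (wCode ++ zeros r) (zeros (X ℕ.+ r))
  wCode-word r = subst₂ (Word wWord) target source (word-++ second first)
    where
    q q' : ℕ
    q  = (suc (d ℕ.+ s) ∸ K) ℕ.+ r
    q' = (s ∸ N) ℕ.+ r
    K≤ : K ≤ suc (d ℕ.+ s)
    K≤ = ℕₚ.≤-pred (subst (K <_) (sym suc-d+s) K<X)
    K+q : K ℕ.+ q ≡ suc (d ℕ.+ s) ℕ.+ r
    K+q = trans (sym (ℕₚ.+-assoc K _ r)) (cong (ℕ._+ r) (ℕₚ.m+[n∸m]≡n K≤))
    N+q' : N ℕ.+ q' ≡ s ℕ.+ r
    N+q' = trans (sym (ℕₚ.+-assoc N _ r)) (cong (ℕ._+ r) (ℕₚ.m+[n∸m]≡n N≤s))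
    P = K ∷ zeros d
    -- After the entry K is in place only zeros follow; they are regrouped so that the second chain
    -- finds its 0 behind N zeros from index d + 1 on.
    middle : K ℕ.+ 0 ∷ zeros K ++ zeros q ≡ P ++ zeros N ++ 0 ∷ zeros q'
    middle = cong₂ _∷_ (ℕₚ.+-identityʳ K) (begin
      zeros K ++ zeros q                     ≡⟨ zeros-+ K q ⟨
      zeros (K ℕ.+ q)                        ≡⟨ cong zeros (trans K+q (trans (cong suc (ℕₚ.+-assoc d s r)) (sym (ℕₚ.+-suc d _)))) ⟩
      zeros (d ℕ.+ suc (s ℕ.+ r))            ≡⟨ cong (λ x → zeros (d ℕ.+ suc x)) N+q' ⟨
      zeros (d ℕ.+ suc (N ℕ.+ q'))           ≡⟨ cong (λ x → zeros (d ℕ.+ x)) (ℕₚ.+-suc N q') ⟨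
      zeros (d ℕ.+ (N ℕ.+ suc q'))           ≡⟨ trans (zeros-+ d _) (cong (zeros d ++_) (zeros-+ N (suc q'))) ⟩
      zeros d ++ zeros N ++ 0 ∷ zeros q' ∎)
      where open ≡-Reasoning
    first : Word (range 0 K) (P ++ zeros N ++ 0 ∷ zeros q') (zeros K ++ 0 ∷ zeros q)
    first = subst (λ t → Word (range 0 K) t (zeros K ++ 0 ∷ zeros q)) middle (raise₀ K 0 (zeros q))
    second : Word (range (suc d) N) (P ++ N ℕ.+ 0 ∷ zeros N ++ zeros q') (P ++ zeros N ++ 0 ∷ zeros q')
    second = subst (λ a → Word (range a N) (P ++ N ℕ.+ 0 ∷ zeros N ++ zeros q') (P ++ zeros N ++ 0 ∷ zeros q'))
      (cong suc (Listₚ.length-replicate d)) (raise P N 0 (zeros q'))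
    target : P ++ N ℕ.+ 0 ∷ zeros N ++ zeros q' ≡ wCode ++ zeros r
    target = cong (K ∷_) (trans (cong (zeros d ++_) (cong₂ _∷_ (ℕₚ.+-identityʳ N)
        (trans (sym (zeros-+ N q')) (trans (cong zeros N+q') (zeros-+ s r)))))
      (sym (Listₚ.++-assoc (zeros d) (N ∷ zeros s) (zeros r))))
    source : zeros K ++ 0 ∷ zeros q ≡ zeros (X ℕ.+ r)
    source = trans (sym (zeros-+ K (suc q))) (cong zeros (trans (ℕₚ.+-suc K q) (trans (cong suc K+q) (cong (ℕ._+ r) suc-d+s))))

  wCode-valid : Valid wCode
  wCode-valid = subst Valid (Listₚ.++-identityʳ wCode) (word-valid (wCode-word 0) (zeros-valid (X ℕ.+ 0)))

  u w : List ℕ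
  u = N ⋆ uPerm (7 ℕ.+ e)
  w = N ⋆ wPerm (7 ℕ.+ e)

  u≡ : u ≡ fromLehmer uCode
  u≡ = cong fromLehmer (trans (dilate N {uPerm (7 ℕ.+ e)} {1} {d} (lehmer-uPerm e)) (cong (_∷ zeros d ++ N ∷ zeros s) (ℕₚ.*-identityʳ N)))

  w≡ : w ≡ fromLehmer wCode
  w≡ = cong fromLehmer (dilate N {wPerm (7 ℕ.+ e)} {3} {d} (lehmer-wPerm e))

  u-isPerm : IsPerm u
  u-isPerm = subst IsPerm (sym u≡) (fromLehmer-isPerm uCode-valid)

  w-isPerm : IsPerm w
  w-isPerm = subst IsPerm (sym w≡) (fromLehmer-isPerm wCode-valid)

  lehmer-u : lehmer u ≡ uCode
  lehmer-u = trans (cong lehmer u≡) (lehmer-fromLehmer uCode-valid)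

  lehmer-w : lehmer w ≡ wCode
  lehmer-w = trans (cong lehmer w≡) (lehmer-fromLehmer wCode-valid)

  length-w : length w ≡ X
  length-w = trans (sym (length-lehmer w)) (trans (cong length lehmer-w) (trans (cong suc (trans (Listₚ.length-++ (zeros d))
    (trans (cong₂ (λ a b → a ℕ.+ suc b) (Listₚ.length-replicate d) (Listₚ.length-replicate s)) (ℕₚ.+-suc d s)))) suc-d+s))

  eval-u : ∀ {F} → Ext F → eval F (𝔖 u) ≡ U F
  eval-u {F} ext = trans (eval-𝔖 F u-isPerm) (trans (cong (λ c → ⟦ c ⟧ F) lehmer-u) (⟦uCode⟧ ext))

  -- The factors are paired one at a time: `T m` with the second for fixed m, then the resulting
  -- functional of m with the first.
  coefficient : ∀ {c} → U (λ m → U (T m)) ≡ c → SchubertCoeff≡ u u w c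
  coefficient e E perms product = trans
    (Dual.coeffAt-product w-isPerm (λ r → subst₂ (λ c n → Word wWord (c ++ zeros r) (zeros (n ℕ.+ r))) (sym lehmer-w) (sym length-w) (wCode-word r))
      u u E perms product)
    (trans (eval-cong (λ m → eval-u (T-ext m)) (𝔖 u)) (trans (eval-u UT-ext) e))

  coefficient-one : N ≡ d ℕ.+ d → SchubertCoeff≡ u u w (+ 1)
  coefficient-one N≡2d = coefficient (Extremal.UUT-one N≡2d)

  coefficient-zero : d ℕ.+ d < N → SchubertCoeff≡ u u w (+ 0)
  coefficient-zero 2d<N = coefficient (UUT-zero 2d<N)

theorem1p3 : (n : ℕ) → 7 ≤ n →
    SchubertCoeff≡ ((2 * n ∸ 6) ⋆ uPerm n) ((2 * n ∸ 6) ⋆ uPerm n) ((2 * n ∸ 6) ⋆ wPerm n) (+ 1)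
    × ((N : ℕ) → 2 * n ∸ 5 ≤ N →
    SchubertCoeff≡ (N ⋆ uPerm n) (N ⋆ uPerm n) (N ⋆ wPerm n) (+ 0))
theorem1p3 n 7≤n with ℕₚ.m≤n⇒∃[o]m+o≡n 7≤n
... | e , refl = one , zero′
  where
  d = 4 ℕ.+ e
  -- The left side is what `2 * (7 + e) ∸ 6` computes to.
  2n∸6 : ∀ e → suc e ℕ.+ (7 ℕ.+ e ℕ.+ 0) ≡ (4 ℕ.+ e) ℕ.+ (4 ℕ.+ e)
  2n∸6 = ℕSolver.solve-∀
  one : SchubertCoeff≡ ((2 * (7 ℕ.+ e) ∸ 6) ⋆ uPerm (7 ℕ.+ e)) ((2 * (7 ℕ.+ e) ∸ 6) ⋆ uPerm (7 ℕ.+ e)) ((2 * (7 ℕ.+ e) ∸ 6) ⋆ wPerm (7 ℕ.+ e)) (+ 1)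
  one = Dilated.coefficient-one e (2 * (7 ℕ.+ e) ∸ 6) (ℕₚ.≤-reflexive (sym (2n∸6 e))) (2n∸6 e)
  zero′ : ∀ N → 2 * (7 ℕ.+ e) ∸ 5 ≤ N → SchubertCoeff≡ (N ⋆ uPerm (7 ℕ.+ e)) (N ⋆ uPerm (7 ℕ.+ e)) (N ⋆ wPerm (7 ℕ.+ e)) (+ 0)
  zero′ N h = Dilated.coefficient-zero e N (ℕₚ.<⇒≤ 2d<N) 2d<N
    where
    2d<N : d ℕ.+ d < N
    -- `2 * n ∸ 5` computes to the successor of `2 * n ∸ 6`, so h is already a strict inequality.
    2d<N = subst (_< N) (2n∸6 e) h
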